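{- Let the polynomial sequence $(b_0(x),b_1(x),\ldots)$ be defined by $b_0(x):=0$ and $b_k(x):=E_{2k-2}\big(\tfrac{x+1}{2}\big)$ for $k\ge1$, where $E_j(x)$ are the Euler polynomials. Then for all $n\ge1$, $$H_n\big(b_k(x)\big)=(-1)^{n-1}\frac{4}{n!^2(x^2-1)}\cdot\mathcal{K}_n(x)\cdot H_n\big(E_{2k}(\tfrac{x+1}{2})\big),$$ where $\mathcal{K}_1(x)=1$ and for $n\ge2$, $$\mathcal{K}_n(x):=1+\sum_{j=1}^{n-1}\frac{2^2}{3^2-x^2}\cdot\frac{4^2}{5^2-x^2}\cdots\frac{(2j)^2}{(2j+1)^2-x^2}.$$
   Context: For a sequence $(a_k)_{k\ge 0}$ and $n\ge 0$, $H_n(a_k):=\det(a_{i+j})_{0\le i,j\le n}$ denotes the $(n+1)\times(n+1)$ Hankel determinant; all sequences are indexed by $k\ge0$. The Euler polynomials are defined by $\frac{2e^{xt}}{e^t+1}=\sum_{n\ge0}E_n(x)\frac{t^n}{n!}$. Here $x$ is a variable, and the identity is one of rational functions in $x$. The notation $n!^2$ means $(n!)^2$. -}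

module Defs where

open import Algebra.Bundles using (RawRing; CommutativeRing; CommutativeSemigroup)
open import Algebra.Definitions using (AlmostLeftCancellative)
import Algebra.Definitions.RawSemiring as RawSemiringDefs
import Algebra.Solver.Ring.NaturalCoefficients.Default as SemiringSolver
import Algebra.Properties.Ring as RingProperties
import Algebra.Properties.CommutativeSemigroup as CommutativeSemigroupProperties
open import Data.Empty using (⊥-elim)
open import Data.Fin.Base using (Fin; zero; suc; toℕ; punchIn)
open import Data.Integer.Base as ℤ using (+_)
import Data.Integer.Properties as ℤ
open import Data.List.Base using (List; []; _∷_; foldr)
open import Data.Nat.Base as ℕ using (ℕ; zero; suc; _∸_; _!)
import Data.Nat.Properties as ℕ using (m^n≢0; *-identityʳ)
open import Data.Nat.Properties using (_!≢0)
open import Data.Product.Base using (_,_)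
open import Data.Rational.Base as ℚ using (ℚ; 0ℚ; 1ℚ; ½)
import Data.Rational.Properties as ℚ
import Data.Rational.Unnormalised.Base as ℚᵘ
import Data.Rational.Unnormalised.Properties as ℚᵘ
open import Level using (Level; 0ℓ; _⊔_)
open import Relation.Binary.Bundles using (Setoid)
import Relation.Binary.Reasoning.Setoid as SetoidReasoning
open import Relation.Binary.PropositionalEquality
  using (_≡_; _≢_; refl; sym; trans; cong; cong₂; module ≡-Reasoning)
open import Relation.Nullary using (¬_; yes; no)

private
  variable
    c ℓ : Level

------------------------------------------------------------------------
-- Determinants

module Determinant (R : RawRing c ℓ) where
  open RawRing R
  open RawSemiringDefs rawSemiring using (sum; _^_)

  -- Laplace expansion along the first row.
  det : ∀ {n} → (Fin n → Fin n → Carrier) → Carrier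
  det {zero}  M = 1#
  det {suc n} M =
    sum λ j → (- 1#) ^ toℕ j * M zero j * det λ i k → M (suc i) (punchIn j k)

  -- The matrix has n + 1 rows and columns.
  hankel : ℕ → (ℕ → Carrier) → Carrier
  hankel n a = det {suc n} λ i j → a (toℕ i ℕ.+ toℕ j)

------------------------------------------------------------------------
-- Formal power series, given by their coefficient sequences

module PowerSeries (R : CommutativeRing c ℓ) where
  open CommutativeRing R
  open SetoidReasoning setoid

  Series : Set c
  Series = ℕ → Carrier

  infix  4 _≋_
  infixl 6 _⊕_
  infixl 7 _⊗_

  _≋_ : Series → Series → Set ℓ
  f ≋ g = ∀ n → f n ≈ g n

  tail : Series → Series
  tail f n = f (suc n)

  constant : Carrier → Series
  constant a zero    = a
  constant a (suc n) = 0#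

  _⊕_ : Series → Series → Series
  (f ⊕ g) n = f n + g n

  -- Coefficient n is f 0 * g n + f 1 * g (n - 1) + ⋯ + f n * g 0.
  _⊗_ : Series → Series → Series
  (f ⊗ g) zero    = f 0 * g 0
  (f ⊗ g) (suc n) = f 0 * g (suc n) + (tail f ⊗ g) n

  ⊗-congˡ : ∀ {f f′} g → f ≋ f′ → f ⊗ g ≋ f′ ⊗ g
  ⊗-congˡ g e zero    = *-congʳ (e 0)
  ⊗-congˡ g e (suc n) = +-cong (*-congʳ (e 0)) (⊗-congˡ g (λ k → e (suc k)) n)

  -- Long division of f by g, where u is the inverse of g 0:  with
  -- q = f 0 * u one has f / g = q + t * ((f - q * g) / t) / g.
  divide : Series → Series → Carrier → Series
  divide f g u zero    = f 0 * u
  divide f g u (suc n) = divide (λ k → f (suc k) - f 0 * u * g (suc k)) g u n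

  divide-⊗ : ∀ f g u → g 0 * u ≈ 1# → divide f g u ⊗ g ≋ f
  divide-⊗ f g u g₀u≈1 zero = begin
    f 0 * u * g 0    ≈⟨ *-assoc _ _ _ ⟩
    f 0 * (u * g 0)  ≈⟨ *-congˡ (CommutativeRing.trans R (*-comm _ _) g₀u≈1) ⟩
    f 0 * 1#         ≈⟨ *-identityʳ _ ⟩
    f 0              ∎
  divide-⊗ f g u g₀u≈1 (suc n) = begin
    y + (divide (λ k → f (suc k) - f 0 * u * g (suc k)) g u ⊗ g) n
      ≈⟨ +-congˡ (divide-⊗ _ g u g₀u≈1 n) ⟩
    y + (f (suc n) - y)    ≈⟨ +-congˡ (+-comm _ _) ⟩
    y + (- y + f (suc n))  ≈⟨ +-assoc _ _ _ ⟨
    y - y + f (suc n)      ≈⟨ +-congʳ (-‿inverseʳ y) ⟩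
    0# + f (suc n)         ≈⟨ +-identityˡ _ ⟩
    f (suc n)              ∎
    where y = f 0 * u * g (suc n)

------------------------------------------------------------------------
-- The field of fractions of an integral domain

module FieldOfFractions
  (D : CommutativeRing c ℓ)
  (1≉0 : ¬ CommutativeRing._≈_ D (CommutativeRing.1# D) (CommutativeRing.0# D))
  (*-cancelˡ : AlmostLeftCancellative
    (CommutativeRing._≈_ D) (CommutativeRing.0# D) (CommutativeRing._*_ D))
  where

  private
    module D = CommutativeRing D
  open D
  open SemiringSolver commutativeSemiring using (solve; _:+_; _:*_; _:=_; con)
  open SetoidReasoning setoid
  open RingProperties ring using (-‿distribˡ-*)

  *-≉0 : ∀ {x y} → ¬ x ≈ 0# → ¬ y ≈ 0# → ¬ x * y ≈ 0#
  *-≉0 x≉0 y≉0 xy≈0 =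
    y≉0 (*-cancelˡ _ _ _ x≉0 (D.trans xy≈0 (D.sym (zeroʳ _))))

  record Fraction : Set (c ⊔ ℓ) where
    constructor _/_[_]
    field
      num   : Carrier
      den   : Carrier
      den≉0 : ¬ den ≈ 0#

  open Fraction

  infix 4 _≃_
  record _≃_ (p q : Fraction) : Set ℓ where
    constructor *≈*
    field cross : num p * den q ≈ num q * den p

  open _≃_

  infixl 6 _+ᶠ_
  infixl 7 _*ᶠ_
  infix  8 -ᶠ_

  ι : Carrier → Fraction
  ι a = a / 1# [ 1≉0 ]

  _+ᶠ_ _*ᶠ_ : Fraction → Fraction → Fraction
  (a / b [ b≉0 ]) +ᶠ (c / d [ d≉0 ]) = (a * d + c * b) / (b * d) [ *-≉0 b≉0 d≉0 ]
  (a / b [ b≉0 ]) *ᶠ (c / d [ d≉0 ]) = (a * c) / (b * d) [ *-≉0 b≉0 d≉0 ]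

  -ᶠ_ : Fraction → Fraction
  -ᶠ (a / b [ b≉0 ]) = (- a) / b [ b≉0 ]

  private
    ≃-trans : ∀ {p q r} → p ≃ q → q ≃ r → p ≃ r
    ≃-trans {a / b [ _ ]} {c / d [ d≉0 ]} {e / f [ _ ]} (*≈* ad≈cb) (*≈* cf≈ed) =
      *≈* (*-cancelˡ d _ _ d≉0 (begin
        d * (a * f)  ≈⟨ solve 3 (λ d a f → d :* (a :* f) := (a :* d) :* f) D.refl d a f ⟩
        (a * d) * f  ≈⟨ *-congʳ ad≈cb ⟩
        (c * b) * f  ≈⟨ solve 3 (λ c b f → (c :* b) :* f := (c :* f) :* b) D.refl c b f ⟩
        (c * f) * b  ≈⟨ *-congʳ cf≈ed ⟩
        (e * d) * b  ≈⟨ solve 3 (λ e d b → (e :* d) :* b := d :* (e :* b)) D.refl e d b ⟩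
        d * (e * b)  ∎))

    +-cong′ : ∀ {p p′ q q′} → p ≃ p′ → q ≃ q′ → p +ᶠ q ≃ p′ +ᶠ q′
    +-cong′ {a / b [ _ ]} {a′ / b′ [ _ ]} {c / d [ _ ]} {c′ / d′ [ _ ]} (*≈* e₁) (*≈* e₂) =
      *≈* (begin
        (a * d + c * b) * (b′ * d′)
          ≈⟨ solve 6 (λ a b c d b′ d′ → (a :* d :+ c :* b) :* (b′ :* d′)
               := (a :* b′) :* (d :* d′) :+ (c :* d′) :* (b :* b′)) D.refl a b c d b′ d′ ⟩
        (a * b′) * (d * d′) + (c * d′) * (b * b′)
          ≈⟨ +-cong (*-congʳ e₁) (*-congʳ e₂) ⟩
        (a′ * b) * (d * d′) + (c′ * d) * (b * b′)
          ≈⟨ solve 6 (λ a′ b c′ d b′ d′ → (a′ :* b) :* (d :* d′) :+ (c′ :* d) :* (b :* b′)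
               := (a′ :* d′ :+ c′ :* b′) :* (b :* d)) D.refl a′ b c′ d b′ d′ ⟩
        (a′ * d′ + c′ * b′) * (b * d)  ∎)

    *-cong′ : ∀ {p p′ q q′} → p ≃ p′ → q ≃ q′ → p *ᶠ q ≃ p′ *ᶠ q′
    *-cong′ {a / b [ _ ]} {a′ / b′ [ _ ]} {c / d [ _ ]} {c′ / d′ [ _ ]} (*≈* e₁) (*≈* e₂) =
      *≈* (begin
        (a * c) * (b′ * d′)
          ≈⟨ solve 4 (λ a c b′ d′ → (a :* c) :* (b′ :* d′) := (a :* b′) :* (c :* d′))
               D.refl a c b′ d′ ⟩
        (a * b′) * (c * d′)
          ≈⟨ *-cong e₁ e₂ ⟩
        (a′ * b) * (c′ * d)
          ≈⟨ solve 4 (λ a′ b c′ d → (a′ :* b) :* (c′ :* d) := (a′ :* c′) :* (b :* d))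
               D.refl a′ b c′ d ⟩
        (a′ * c′) * (b * d)  ∎)

    neg-cong : ∀ {p q} → p ≃ q → -ᶠ p ≃ -ᶠ q
    neg-cong {a / b [ _ ]} {c / d [ _ ]} (*≈* e) = *≈* (begin
      - a * d    ≈⟨ -‿distribˡ-* a d ⟨
      - (a * d)  ≈⟨ -‿cong e ⟩
      - (c * b)  ≈⟨ -‿distribˡ-* c b ⟩
      - c * b    ∎)

    neg-inverseˡ : ∀ p → -ᶠ p +ᶠ p ≃ ι 0#
    neg-inverseˡ (a / b [ _ ]) = *≈* (begin
      (- a * b + a * b) * 1#  ≈⟨ *-identityʳ _ ⟩
      - a * b + a * b         ≈⟨ distribʳ b (- a) a ⟨
      (- a + a) * b           ≈⟨ *-congʳ (-‿inverseˡ a) ⟩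
      0# * b                  ≈⟨ zeroˡ b ⟩
      0#                      ≈⟨ zeroˡ (b * b) ⟨
      0# * (b * b)            ∎)

    +-comm′ : ∀ p q → p +ᶠ q ≃ q +ᶠ p
    +-comm′ (a / b [ _ ]) (c / d [ _ ]) = *≈*
      (solve 4 (λ a b c d → (a :* d :+ c :* b) :* (d :* b) := (c :* b :+ a :* d) :* (b :* d))
        D.refl a b c d)

    *-comm′ : ∀ p q → p *ᶠ q ≃ q *ᶠ p
    *-comm′ (a / b [ _ ]) (c / d [ _ ]) = *≈*
      (solve 4 (λ a b c d → (a :* c) :* (d :* b) := (c :* a) :* (b :* d)) D.refl a b c d)

    +-identityˡ′ : ∀ p → ι 0# +ᶠ p ≃ p
    +-identityˡ′ (a / b [ _ ]) = *≈*
      (solve 2 (λ a b → (con 0 :* b :+ a :* con 1) :* b := a :* (con 1 :* b)) D.refl a b)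

    *-identityˡ′ : ∀ p → ι 1# *ᶠ p ≃ p
    *-identityˡ′ (a / b [ _ ]) = *≈*
      (solve 2 (λ a b → (con 1 :* a) :* b := a :* (con 1 :* b)) D.refl a b)

    distribˡ′ : ∀ p q r → p *ᶠ (q +ᶠ r) ≃ p *ᶠ q +ᶠ p *ᶠ r
    distribˡ′ (a / b [ _ ]) (c / d [ _ ]) (e / f [ _ ]) = *≈*
      (solve 6 (λ a b c d e f →
           (a :* (c :* f :+ e :* d)) :* ((b :* d) :* (b :* f))
        := ((a :* c) :* (b :* f) :+ (a :* e) :* (b :* d)) :* (b :* (d :* f)))
        D.refl a b c d e f)

  fractionRing : CommutativeRing (c ⊔ ℓ) ℓ
  fractionRing = record
    { Carrier = Fraction ; _≈_ = _≃_ ; _+_ = _+ᶠ_ ; _*_ = _*ᶠ_ ; -_ = -ᶠ_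
    ; 0# = ι 0# ; 1# = ι 1#
    ; isCommutativeRing = record
      { isRing = record
        { +-isAbelianGroup = record
          { isGroup = record
            { isMonoid = record
              { isSemigroup = record
                { isMagma = record
                  { isEquivalence = record
                    { refl  = *≈* D.refl
                    ; sym   = λ e → *≈* (D.sym (cross e))
                    ; trans = ≃-trans }
                  ; ∙-cong = +-cong′ }
                ; assoc = λ { (a / b [ _ ]) (c / d [ _ ]) (e / f [ _ ]) → *≈*
                    (solve 6 (λ a b c d e f →
                         ((a :* d :+ c :* b) :* f :+ e :* (b :* d)) :* (b :* (d :* f))
                      := (a :* (d :* f) :+ (c :* f :+ e :* d) :* b) :* ((b :* d) :* f))
                      D.refl a b c d e f) } }
              ; identity = +-identityˡ′ , λ p → ≃-trans (+-comm′ p (ι 0#)) (+-identityˡ′ p) }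
            ; inverse = neg-inverseˡ , λ p → ≃-trans (+-comm′ p (-ᶠ p)) (neg-inverseˡ p)
            ; ⁻¹-cong = neg-cong }
          ; comm = +-comm′ }
        ; *-cong = *-cong′
        ; *-assoc = λ { (a / b [ _ ]) (c / d [ _ ]) (e / f [ _ ]) → *≈*
            (solve 6 (λ a b c d e f → ((a :* c) :* e) :* (b :* (d :* f))
                                   := (a :* (c :* e)) :* ((b :* d) :* f))
              D.refl a b c d e f) }
        ; *-identity = *-identityˡ′ , λ p → ≃-trans (*-comm′ p (ι 1#)) (*-identityˡ′ p)
        ; distrib = distribˡ′ , λ p q r →
            ≃-trans (*-comm′ (q +ᶠ r) p)
              (≃-trans (distribˡ′ p q r) (+-cong′ (*-comm′ p q) (*-comm′ p r))) }
      ; *-comm = *-comm′ } }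

------------------------------------------------------------------------
-- The ring ℚ[X]

-- The polynomial a₀ + a₁X + ⋯ + aₘXᵐ is a₀ ∷ a₁ ∷ ⋯ ∷ aₘ ∷ [];
-- trailing zeros are allowed and ignored by the equality _≈ₚ_.
Poly : Set
Poly = List ℚ

coeff : Poly → ℕ → ℚ
coeff []      _       = 0ℚ
coeff (a ∷ p) zero    = a
coeff (a ∷ p) (suc n) = coeff p n

infix  4 _≈ₚ_
infixl 6 _+ₚ_ _-ₚ_
infixl 7 _*ₚ_ _·_
infix  8 -ₚ_

record _≈ₚ_ (p q : Poly) : Set where
  constructor coeffs
  field at : ∀ n → coeff p n ≡ coeff q n

open _≈ₚ_ public

const : ℚ → Poly
const a = a ∷ []

X : Poly
X = 0ℚ ∷ 1ℚ ∷ []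

_+ₚ_ : Poly → Poly → Poly
[]      +ₚ q       = q
(a ∷ p) +ₚ []      = a ∷ p
(a ∷ p) +ₚ (b ∷ q) = a ℚ.+ b ∷ p +ₚ q

_·_ : ℚ → Poly → Poly
a · []      = []
a · (b ∷ p) = a ℚ.* b ∷ a · p

-ₚ_ : Poly → Poly
-ₚ []      = []
-ₚ (a ∷ p) = ℚ.- a ∷ -ₚ p

_-ₚ_ : Poly → Poly → Poly
p -ₚ q = p +ₚ -ₚ q

_*ₚ_ : Poly → Poly → Poly
[]      *ₚ q = []
(a ∷ p) *ₚ q = a · q +ₚ (0ℚ ∷ p *ₚ q)

coeff-+ : ∀ p q n → coeff (p +ₚ q) n ≡ coeff p n ℚ.+ coeff q n
coeff-+ []      q       n       = sym (ℚ.+-identityˡ _)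
coeff-+ (a ∷ p) []      n       = sym (ℚ.+-identityʳ _)
coeff-+ (a ∷ p) (b ∷ q) zero    = refl
coeff-+ (a ∷ p) (b ∷ q) (suc n) = coeff-+ p q n

coeff-· : ∀ a p n → coeff (a · p) n ≡ a ℚ.* coeff p n
coeff-· a []      n       = sym (ℚ.*-zeroʳ a)
coeff-· a (b ∷ p) zero    = refl
coeff-· a (b ∷ p) (suc n) = coeff-· a p n

coeff-neg : ∀ p n → coeff (-ₚ p) n ≡ ℚ.- coeff p n
coeff-neg []      n       = refl
coeff-neg (a ∷ p) zero    = refl
coeff-neg (a ∷ p) (suc n) = coeff-neg p n

private
  ≈-refl : ∀ {p} → p ≈ₚ p
  ≈-refl = coeffs λ _ → refl

  ≈-sym : ∀ {p q} → p ≈ₚ q → q ≈ₚ p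
  ≈-sym e = coeffs λ n → sym (at e n)

  ≈-trans : ∀ {p q r} → p ≈ₚ q → q ≈ₚ r → p ≈ₚ r
  ≈-trans e f = coeffs λ n → trans (at e n) (at f n)

  polySetoid : Setoid 0ℓ 0ℓ
  polySetoid = record
    { Carrier = Poly ; _≈_ = _≈ₚ_
    ; isEquivalence = record { refl = ≈-refl ; sym = ≈-sym ; trans = ≈-trans } }

  ℚ-zero-product : ∀ {a b} → a ≢ 0ℚ → a ℚ.* b ≡ 0ℚ → b ≡ 0ℚ
  ℚ-zero-product {a} {b} a≢0 ab≡0 = let open ≡-Reasoning in begin
    b                          ≡⟨ ℚ.*-identityˡ b ⟨
    1ℚ ℚ.* b                   ≡⟨ cong (ℚ._* b) (ℚ.*-inverseˡ a) ⟨
    (ℚ.1/ a ℚ.* a) ℚ.* b       ≡⟨ ℚ.*-assoc (ℚ.1/ a) a b ⟩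
    ℚ.1/ a ℚ.* (a ℚ.* b)       ≡⟨ cong (ℚ.1/ a ℚ.*_) ab≡0 ⟩
    ℚ.1/ a ℚ.* 0ℚ              ≡⟨ ℚ.*-zeroʳ (ℚ.1/ a) ⟩
    0ℚ                         ∎
    where instance _ = ℚ.≢-nonZero a≢0

  ∷-cong : ∀ {a b p q} → a ≡ b → p ≈ₚ q → a ∷ p ≈ₚ b ∷ q
  ∷-cong a≡b p≈q = coeffs λ { zero → a≡b ; (suc n) → at p≈q n }

  ∷-tail : ∀ {a b p q} → a ∷ p ≈ₚ b ∷ q → p ≈ₚ q
  ∷-tail e = coeffs λ n → at e (suc n)

  +-cong : ∀ {p p′ q q′} → p ≈ₚ p′ → q ≈ₚ q′ → p +ₚ q ≈ₚ p′ +ₚ q′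
  +-cong {p} {p′} {q} {q′} e f = coeffs λ n →
    trans (coeff-+ p q n) (trans (cong₂ ℚ._+_ (at e n) (at f n)) (sym (coeff-+ p′ q′ n)))

  +-assoc : ∀ p q r → (p +ₚ q) +ₚ r ≈ₚ p +ₚ (q +ₚ r)
  +-assoc p q r = coeffs λ n → let open ≡-Reasoning in begin
    coeff ((p +ₚ q) +ₚ r) n                    ≡⟨ coeff-+ (p +ₚ q) r n ⟩
    coeff (p +ₚ q) n ℚ.+ coeff r n             ≡⟨ cong (ℚ._+ _) (coeff-+ p q n) ⟩
    (coeff p n ℚ.+ coeff q n) ℚ.+ coeff r n    ≡⟨ ℚ.+-assoc (coeff p n) _ _ ⟩
    coeff p n ℚ.+ (coeff q n ℚ.+ coeff r n)    ≡⟨ cong (coeff p n ℚ.+_) (coeff-+ q r n) ⟨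
    coeff p n ℚ.+ coeff (q +ₚ r) n             ≡⟨ coeff-+ p (q +ₚ r) n ⟨
    coeff (p +ₚ (q +ₚ r)) n                    ∎

  +-comm : ∀ p q → p +ₚ q ≈ₚ q +ₚ p
  +-comm p q = coeffs λ n →
    trans (coeff-+ p q n) (trans (ℚ.+-comm (coeff p n) _) (sym (coeff-+ q p n)))

  +-identityʳ : ∀ p → p +ₚ [] ≈ₚ p
  +-identityʳ p = +-comm p []

  neg-cong : ∀ {p q} → p ≈ₚ q → -ₚ p ≈ₚ -ₚ q
  neg-cong {p} {q} e = coeffs λ n →
    trans (coeff-neg p n) (trans (cong ℚ.-_ (at e n)) (sym (coeff-neg q n)))

  neg-inverseˡ : ∀ p → -ₚ p +ₚ p ≈ₚ []
  neg-inverseˡ p = coeffs λ n → trans (coeff-+ (-ₚ p) p n)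
    (trans (cong (ℚ._+ coeff p n) (coeff-neg p n)) (ℚ.+-inverseˡ (coeff p n)))

  open SetoidReasoning polySetoid
  +-commutativeSemigroup : CommutativeSemigroup 0ℓ 0ℓ
  +-commutativeSemigroup = record
    { isCommutativeSemigroup = record
      { isSemigroup = record
        { isMagma = record
          { isEquivalence = Setoid.isEquivalence polySetoid ; ∙-cong = +-cong }
        ; assoc = +-assoc }
      ; comm = +-comm } }

  open CommutativeSemigroupProperties +-commutativeSemigroup
    using (x∙yz≈y∙xz; interchange)

  0∷[]≈[] : 0ℚ ∷ [] ≈ₚ []
  0∷[]≈[] = coeffs λ { zero → refl ; (suc n) → refl }

  ·-cong : ∀ a {p q} → p ≈ₚ q → a · p ≈ₚ a · q
  ·-cong a {p} {q} e = coeffs λ n →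
    trans (coeff-· a p n) (trans (cong (a ℚ.*_) (at e n)) (sym (coeff-· a q n)))

  ·-distribˡ : ∀ a p q → a · (p +ₚ q) ≈ₚ a · p +ₚ a · q
  ·-distribˡ a []      q       = ≈-refl
  ·-distribˡ a (b ∷ p) []      = ≈-refl
  ·-distribˡ a (b ∷ p) (d ∷ q) = ∷-cong (ℚ.*-distribˡ-+ a b d) (·-distribˡ a p q)

  ·-assoc : ∀ a b p → a · (b · p) ≈ₚ (a ℚ.* b) · p
  ·-assoc a b []      = ≈-refl
  ·-assoc a b (d ∷ p) = ∷-cong (sym (ℚ.*-assoc a b d)) (·-assoc a b p)

  1· : ∀ p → 1ℚ · p ≈ₚ p
  1· p = coeffs λ n → trans (coeff-· 1ℚ p n) (ℚ.*-identityˡ _)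

  0· : ∀ p → 0ℚ · p ≈ₚ []
  0· p = coeffs λ n → trans (coeff-· 0ℚ p n) (ℚ.*-zeroˡ (coeff p n))

  *-congˡ : ∀ p {q q′} → q ≈ₚ q′ → p *ₚ q ≈ₚ p *ₚ q′
  *-congˡ []      e = ≈-refl
  *-congˡ (a ∷ p) e = +-cong (·-cong a e) (∷-cong refl (*-congˡ p e))

  *-zeroʳ : ∀ p → p *ₚ [] ≈ₚ []
  *-zeroʳ []      = ≈-refl
  *-zeroʳ (a ∷ p) = ≈-trans (∷-cong refl (*-zeroʳ p)) 0∷[]≈[]

  *-∷ʳ : ∀ p b q → p *ₚ (b ∷ q) ≈ₚ b · p +ₚ (0ℚ ∷ p *ₚ q)
  *-∷ʳ []      b q = ≈-sym 0∷[]≈[]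
  *-∷ʳ (a ∷ p) b q = ∷-cong (cong (ℚ._+ 0ℚ) (ℚ.*-comm a b)) (begin
    a · q +ₚ p *ₚ (b ∷ q)               ≈⟨ +-cong ≈-refl (*-∷ʳ p b q) ⟩
    a · q +ₚ (b · p +ₚ (0ℚ ∷ p *ₚ q))   ≈⟨ x∙yz≈y∙xz (a · q) (b · p) _ ⟩
    b · p +ₚ (a · q +ₚ (0ℚ ∷ p *ₚ q))   ∎)

  *-comm : ∀ p q → p *ₚ q ≈ₚ q *ₚ p
  *-comm []      q = ≈-sym (*-zeroʳ q)
  *-comm (a ∷ p) q = begin
    a · q +ₚ (0ℚ ∷ p *ₚ q)  ≈⟨ +-cong ≈-refl (∷-cong refl (*-comm p q)) ⟩
    a · q +ₚ (0ℚ ∷ q *ₚ p)  ≈⟨ *-∷ʳ q a p ⟨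
    q *ₚ (a ∷ p)            ∎

  *-cong : ∀ {p p′ q q′} → p ≈ₚ p′ → q ≈ₚ q′ → p *ₚ q ≈ₚ p′ *ₚ q′
  *-cong {p} {p′} {q} {q′} e f = begin
    p *ₚ q    ≈⟨ *-congˡ p f ⟩
    p *ₚ q′   ≈⟨ *-comm p q′ ⟩
    q′ *ₚ p   ≈⟨ *-congˡ q′ e ⟩
    q′ *ₚ p′  ≈⟨ *-comm q′ p′ ⟩
    p′ *ₚ q′  ∎

  distribˡ : ∀ p q r → p *ₚ (q +ₚ r) ≈ₚ p *ₚ q +ₚ p *ₚ r
  distribˡ []      q r = ≈-refl
  distribˡ (a ∷ p) q r = begin
    a · (q +ₚ r) +ₚ (0ℚ ∷ p *ₚ (q +ₚ r))
      ≈⟨ +-cong (·-distribˡ a q r) (∷-cong (sym (ℚ.+-identityˡ 0ℚ)) (distribˡ p q r)) ⟩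
    (a · q +ₚ a · r) +ₚ ((0ℚ ∷ p *ₚ q) +ₚ (0ℚ ∷ p *ₚ r))
      ≈⟨ interchange (a · q) (a · r) _ _ ⟩
    (a · q +ₚ (0ℚ ∷ p *ₚ q)) +ₚ (a · r +ₚ (0ℚ ∷ p *ₚ r))
      ∎

  distribʳ : ∀ p q r → (q +ₚ r) *ₚ p ≈ₚ q *ₚ p +ₚ r *ₚ p
  distribʳ p q r = begin
    (q +ₚ r) *ₚ p         ≈⟨ *-comm (q +ₚ r) p ⟩
    p *ₚ (q +ₚ r)         ≈⟨ distribˡ p q r ⟩
    p *ₚ q +ₚ p *ₚ r      ≈⟨ +-cong (*-comm p q) (*-comm p r) ⟩
    q *ₚ p +ₚ r *ₚ p      ∎

  ·-*-assoc : ∀ a p q → (a · p) *ₚ q ≈ₚ a · (p *ₚ q)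
  ·-*-assoc a []      q = ≈-refl
  ·-*-assoc a (b ∷ p) q = begin
    (a ℚ.* b) · q +ₚ (0ℚ ∷ (a · p) *ₚ q)
      ≈⟨ +-cong (≈-sym (·-assoc a b q)) (∷-cong (sym (ℚ.*-zeroʳ a)) (·-*-assoc a p q)) ⟩
    a · (b · q) +ₚ a · (0ℚ ∷ p *ₚ q)
      ≈⟨ ·-distribˡ a (b · q) _ ⟨
    a · (b · q +ₚ (0ℚ ∷ p *ₚ q))
      ∎

  *-assoc : ∀ p q r → (p *ₚ q) *ₚ r ≈ₚ p *ₚ (q *ₚ r)
  *-assoc []      q r = ≈-refl
  *-assoc (a ∷ p) q r = begin
    (a · q +ₚ (0ℚ ∷ p *ₚ q)) *ₚ r
      ≈⟨ distribʳ r (a · q) _ ⟩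
    (a · q) *ₚ r +ₚ (0ℚ · r +ₚ (0ℚ ∷ (p *ₚ q) *ₚ r))
      ≈⟨ +-cong (·-*-assoc a q r) (+-cong (0· r) (∷-cong refl (*-assoc p q r))) ⟩
    a · (q *ₚ r) +ₚ (0ℚ ∷ p *ₚ (q *ₚ r))
      ∎

  *-identityˡ : ∀ p → const 1ℚ *ₚ p ≈ₚ p
  *-identityˡ p = begin
    1ℚ · p +ₚ (0ℚ ∷ [])  ≈⟨ +-cong (1· p) 0∷[]≈[] ⟩
    p +ₚ []              ≈⟨ +-identityʳ p ⟩
    p                    ∎

ℚ[X] : CommutativeRing 0ℓ 0ℓ
ℚ[X] = record
  { Carrier = Poly ; _≈_ = _≈ₚ_ ; _+_ = _+ₚ_ ; _*_ = _*ₚ_ ; -_ = -ₚ_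
  ; 0# = [] ; 1# = const 1ℚ
  ; isCommutativeRing = record
    { isRing = record
      { +-isAbelianGroup = record
        { isGroup = record
          { isMonoid = record
            { isSemigroup = record
              { isMagma = record
                { isEquivalence = Setoid.isEquivalence polySetoid
                ; ∙-cong = +-cong }
              ; assoc = +-assoc }
            ; identity = (λ _ → ≈-refl) , +-identityʳ }
          ; inverse = neg-inverseˡ , λ p → ≈-trans (+-comm p _) (neg-inverseˡ p)
          ; ⁻¹-cong = neg-cong }
        ; comm = +-comm }
      ; *-cong = *-cong
      ; *-assoc = *-assoc
      ; *-identity = *-identityˡ , λ p → ≈-trans (*-comm p _) (*-identityˡ p)
      ; distrib = distribˡ , distribʳ }
    ; *-comm = *-comm } }

1≉0ₚ : ¬ const 1ℚ ≈ₚ []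
1≉0ₚ e with () ← at e 0

private
  zero-product₀ : ∀ {a} p q → a ≢ 0ℚ → (a ∷ p) *ₚ q ≈ₚ [] → q ≈ₚ []
  zero-product₀ p []      a≢0 e = ≈-refl
  zero-product₀ {a} p (b ∷ q) a≢0 e =
    ≈-trans (∷-cong b≡0 (zero-product₀ p q a≢0 tail≈0)) 0∷[]≈[]
    where
    b≡0 : b ≡ 0ℚ
    b≡0 = ℚ-zero-product a≢0 (trans (sym (ℚ.+-identityʳ (a ℚ.* b))) (at e 0))

    shift : (a ∷ p) *ₚ (b ∷ q) ≈ₚ 0ℚ ∷ (a ∷ p) *ₚ q
    shift = begin
      (a ∷ p) *ₚ (b ∷ q)                       ≈⟨ *-∷ʳ (a ∷ p) b q ⟩
      b · (a ∷ p) +ₚ (0ℚ ∷ (a ∷ p) *ₚ q)       ≡⟨ cong (λ x → x · (a ∷ p) +ₚ (0ℚ ∷ (a ∷ p) *ₚ q)) b≡0 ⟩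
      0ℚ · (a ∷ p) +ₚ (0ℚ ∷ (a ∷ p) *ₚ q)      ≈⟨ +-cong (0· (a ∷ p)) ≈-refl ⟩
      0ℚ ∷ (a ∷ p) *ₚ q                        ∎

    tail≈0 : (a ∷ p) *ₚ q ≈ₚ []
    tail≈0 = coeffs λ n → trans (sym (at shift (suc n))) (at e (suc n))

  zero-product : ∀ p q → ¬ p ≈ₚ [] → p *ₚ q ≈ₚ [] → q ≈ₚ []
  zero-product []      q p≉0 e = ⊥-elim (p≉0 ≈-refl)
  zero-product (a ∷ p) q p≉0 e with a ℚ.≟ 0ℚ
  ... | no  a≢0  = zero-product₀ p q a≢0 e
  ... | yes refl = zero-product p q
    (λ p≈0 → p≉0 (≈-trans (∷-cong refl p≈0) 0∷[]≈[]))
    (∷-tail (begin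
      0ℚ ∷ p *ₚ q                ≈⟨ +-cong (0· q) ≈-refl ⟨
      0ℚ · q +ₚ (0ℚ ∷ p *ₚ q)    ≈⟨ e ⟩
      []                         ≈⟨ 0∷[]≈[] ⟨
      0ℚ ∷ []                    ∎))

*ₚ-cancelˡ : AlmostLeftCancellative _≈ₚ_ [] _*ₚ_
*ₚ-cancelˡ p q r p≉0 pq≈pr = x-y≈0⇒x≈y q r (zero-product p (q -ₚ r) p≉0 (begin
  p *ₚ (q -ₚ r)          ≈⟨ x[y-z]≈xy-xz p q r ⟩
  p *ₚ q -ₚ p *ₚ r       ≈⟨ x≈y⇒x-y≈0 pq≈pr ⟩
  []                     ∎))
  where
  open RingProperties (CommutativeRing.ring ℚ[X]) using (x[y-z]≈xy-xz)

  x≈y⇒x-y≈0 : ∀ {x y} → x ≈ₚ y → x -ₚ y ≈ₚ []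
  x≈y⇒x-y≈0 {x} {y} e = ≈-trans (+-cong e ≈-refl)
    (≈-trans (+-comm y (-ₚ y)) (neg-inverseˡ y))

  x-y≈0⇒x≈y : ∀ x y → x -ₚ y ≈ₚ [] → x ≈ₚ y
  x-y≈0⇒x≈y x y e = begin
    x                     ≈⟨ +-identityʳ x ⟨
    x +ₚ []               ≈⟨ +-cong (≈-refl {x}) (neg-inverseˡ y) ⟨
    x +ₚ (-ₚ y +ₚ y)      ≈⟨ +-assoc x (-ₚ y) y ⟨
    (x -ₚ y) +ₚ y         ≈⟨ +-cong e ≈-refl ⟩
    y                     ∎

infixr 8 _^ₚ_
_^ₚ_ : Poly → ℕ → Poly
_^ₚ_ = RawSemiringDefs._^_ (RawRing.rawSemiring (CommutativeRing.rawRing ℚ[X]))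

fromℕ : ℕ → Poly
fromℕ m = const (+ m ℚ./ 1)

infixl 9 _∘ₚ_
_∘ₚ_ : Poly → Poly → Poly
p ∘ₚ q = foldr (λ a r → const a +ₚ q *ₚ r) [] p

------------------------------------------------------------------------
-- Euler polynomials

open PowerSeries ℚ[X] public

1/_! : ℕ → ℚ
1/ n ! = ℚ._/_ (+ 1) (n !) {{n !≢0}}

-- The series e^(pt) in ℚ[X][[t]].
exp : Poly → Series
exp p n = const (1/ n !) *ₚ p ^ₚ n

2e^Xt e^t+1 : Series
2e^Xt = constant (fromℕ 2) ⊗ exp X
e^t+1 = exp (fromℕ 1) ⊕ constant (fromℕ 1)

-- n! times the coefficient of tⁿ in 2e^(Xt) / (e^t + 1); the constant
-- term of the denominator is 2.
E : ℕ → Poly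
E n = fromℕ (n !) *ₚ divide 2e^Xt e^t+1 (const ½) n

private
  1/m*m≡1 : ∀ m .{{_ : ℕ.NonZero m}} → (+ 1 ℚ./ m) ℚ.* (+ m ℚ./ 1) ≡ 1ℚ
  1/m*m≡1 (suc k) = ℚ.toℚᵘ-injective (ℚᵘ.≃-trans
    (ℚ.toℚᵘ-homo-* (ℚ.fromℚᵘ p) (ℚ.fromℚᵘ q))
    (ℚᵘ.≃-trans (ℚᵘ.*-cong (ℚ.toℚᵘ-fromℚᵘ p) (ℚ.toℚᵘ-fromℚᵘ q))
      (ℚᵘ.*≡* (trans (ℤ.*-identityʳ (+ 1 ℤ.* + suc k))
        (cong (λ m → + 1 ℤ.* + suc m) (sym (ℕ.*-identityʳ k)))))))
    where
    p = ℚᵘ.mkℚᵘ (+ 1) k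
    q = ℚᵘ.mkℚᵘ (+ suc k) 0

E-generating-function : (λ n → const (1/ n !) *ₚ E n) ⊗ e^t+1 ≋ 2e^Xt
E-generating-function n = ≈-trans
  (⊗-congˡ e^t+1 cancel n)
  (divide-⊗ 2e^Xt e^t+1 (const ½) (coeffs λ { zero → refl ; (suc _) → refl }) n)
  where
  cancel : ∀ k → const (1/ k !) *ₚ E k ≈ₚ divide 2e^Xt e^t+1 (const ½) k
  cancel k = begin
    const (1/ k !) *ₚ (fromℕ (k !) *ₚ q)   ≈⟨ *-assoc (const (1/ k !)) (fromℕ (k !)) q ⟨
    (const (1/ k !) *ₚ fromℕ (k !)) *ₚ q   ≈⟨ *-cong 1/k!*k!≈1 (≈-refl {q}) ⟩
    const 1ℚ *ₚ q                          ≈⟨ *-identityˡ q ⟩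
    q                                      ∎
    where
    q = divide 2e^Xt e^t+1 (const ½) k

    1/k!*k!≈1 : const (1/ k !) *ₚ fromℕ (k !) ≈ₚ const 1ℚ
    1/k!*k!≈1 = ∷-cong
      (trans (ℚ.+-identityʳ _) (1/m*m≡1 (k !) {{k !≢0}})) ≈-refl

------------------------------------------------------------------------
-- The field ℚ(X)

open FieldOfFractions ℚ[X] 1≉0ₚ *ₚ-cancelˡ public
  using (Fraction; module Fraction; _/_[_]; _≃_; module _≃_; *≈*; ι; *-≉0)
  renaming (fractionRing to ℚ⟨X⟩)
open CommutativeRing ℚ⟨X⟩ public using (_≈_; _+_; _*_; -_; 0#; 1#)
open RawSemiringDefs (RawRing.rawSemiring (CommutativeRing.rawRing ℚ⟨X⟩)) public
  using (sum; product; _^_)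
open Determinant (CommutativeRing.rawRing ℚ[X]) public renaming (hankel to H)

fromℕ≉0 : ∀ m → .{{ℕ.NonZero m}} → ¬ fromℕ m ≈ₚ []
fromℕ≉0 m e = ℚ.<-irrefl (sym (at e 0))
  (ℚ.positive⁻¹ (+ m ℚ./ 1) {{ℚ.normalize-pos m 1}})

X²-1≉0 : ¬ X ^ₚ 2 -ₚ fromℕ 1 ≈ₚ []
X²-1≉0 e with () ← at e 2

m-X²≉0 : ∀ m → ¬ fromℕ m -ₚ X ^ₚ 2 ≈ₚ []
m-X²≉0 m e with () ← at e 2

n!²[X²-1]≉0 : ∀ n → ¬ fromℕ ((n !) ℕ.^ 2) *ₚ (X ^ₚ 2 -ₚ fromℕ 1) ≈ₚ []
n!²[X²-1]≉0 n = *-≉0 (fromℕ≉0 ((n !) ℕ.^ 2) {{ℕ.m^n≢0 (n !) 2 {{n !≢0}}}}) X²-1≉0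

factor : ℕ → Fraction
factor i = fromℕ ((2 ℕ.* i) ℕ.^ 2) / (fromℕ ((2 ℕ.* i ℕ.+ 1) ℕ.^ 2) -ₚ X ^ₚ 2)
  [ m-X²≉0 ((2 ℕ.* i ℕ.+ 1) ℕ.^ 2) ]

-- The summation index here is one less than the usual j = 1, …, n - 1;
-- for n = 1 the sum is empty.
𝒦 : ℕ → Fraction
𝒦 n = 1# + sum {n ∸ 1} λ j → product {suc (toℕ j)} λ i → factor (suc (toℕ i))

½[X+1] : Poly
½[X+1] = ½ · (X +ₚ fromℕ 1)

b : ℕ → Poly
b zero      = []
b k@(suc _) = E (2 ℕ.* k ∸ 2) ∘ₚ ½[X+1]

{-# OPTIONS --safe #-}
module Submission where

-- Let c_k = E_2k(y) with y = (x + 1)/2, and let L be the linear functional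
-- z^k ↦ c_k.  From Σ C(n,i) E_i + E_n = 2 X^n, applied to the polynomial
-- ∏_{i=1..k} (t - i)(t + i - 1), one reads off
--   L(∏_{j<k} (z - j²)) = ∏_{j<k} (-A_j),   A_j = (j + 1 - y)(y + j) = ((2j + 1)² - x²)/4.
-- Hence L has the Stieltjes fraction with coefficients -A_0, -1², -A_1, -2², …,
-- whose denominators P_n satisfy L(P_n z^j) = 0 for j < n, L(P_n z^n) = n!² P_n(0)
-- and P_n(0) = ∏_{j<n} A_j.  Replacing the first row of a Hankel matrix by the
-- combination of rows prescribed by P_n multiplies its determinant by P_n(0).  For
-- both (c_k) and its right shift (b_k) the new first row has a single nonzero entry,
-- and the two cofactors agree up to sign, so
--   H_n(b) n!² P_n(0) = (-1)^n L((P_n - P_n(0))/z) H_n(c).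
-- The remaining factor obeys M_{n+1} = n!² + A_n M_n, which gives 𝒦_n.

open import Algebra.Bundles using (CommutativeRing; RawRing)
import Algebra.Definitions.RawSemiring as RawSemiringDefs
import Algebra.Properties.CommutativeSemigroup as CommutativeSemigroupProperties
import Algebra.Properties.Ring as RingProperties
import Algebra.Properties.Semiring.Sum as SemiringSum
import Algebra.Solver.Ring as RingSolver
open import Algebra.Solver.Ring.AlmostCommutativeRing
  using (_-Raw-AlmostCommutative⟶_; fromCommutativeRing)
import Algebra.Solver.Ring.NaturalCoefficients.Default as SemiringSolver
open import Data.Fin.Base as Fin using (Fin; zero; suc; toℕ; fromℕ<; inject₁; punchIn; pinch)
import Data.Fin.Properties as Fin
open import Data.Integer.Base as ℤ using (+_)
import Data.Integer.Properties as ℤ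
open import Data.List.Base using ([]; _∷_)
open import Data.Maybe.Base using (just; nothing)
open import Data.Nat.Base as ℕ using (ℕ; zero; suc; _≤_; _<_; _∸_; _!)
import Data.Nat.Properties as ℕ
open import Data.Rational.Base as ℚ using (0ℚ; 1ℚ)
import Data.Rational.Properties as ℚ
open import Data.Rational.Unnormalised.Base as ℚᵘ using (mkℚᵘ)
import Data.Rational.Unnormalised.Properties as ℚᵘ
open import Defs using (module Determinant; module PowerSeries)
open import Level using (Level)
open import Relation.Binary.Definitions using (WeaklyDecidable)
open import Relation.Binary.PropositionalEquality as ≡ using (_≡_)
import Relation.Binary.Reasoning.Setoid as SetoidReasoning
open import Relation.Nullary using (¬_; yes; no)

private
  variable
    c ℓ : Level

-- Ordered pairs of distinct columns

punchIn-comm : ∀ {n} (j : Fin (suc (suc n))) (k : Fin (suc n)) (i : Fin n) →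
  punchIn (punchIn j k) (punchIn (pinch k j) i) ≡ punchIn j (punchIn k i)
punchIn-comm zero    k       i       = ≡.refl
punchIn-comm (suc j) zero    i       = ≡.refl
punchIn-comm (suc j) (suc k) zero    = ≡.refl
punchIn-comm (suc j) (suc k) (suc i) = ≡.cong suc (punchIn-comm j k i)

-- `pinch k j` is the index of column `j` among the columns other than `punchIn j k`, so the same
-- two columns are met in the opposite order.
punchIn-pinch : ∀ {n} (j : Fin (suc n)) (k : Fin n) → punchIn (punchIn j k) (pinch k j) ≡ j
punchIn-pinch {suc n} zero    k       = ≡.refl
punchIn-pinch {suc n} (suc j) zero    = ≡.refl
punchIn-pinch {suc n} (suc j) (suc k) = ≡.cong suc (punchIn-pinch j k)

toℕ-punchIn-fromℕ : ∀ n (k : Fin n) → toℕ (punchIn (Fin.fromℕ n) k) ≡ toℕ k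
toℕ-punchIn-fromℕ (suc n) zero    = ≡.refl
toℕ-punchIn-fromℕ (suc n) (suc k) = ≡.cong suc (toℕ-punchIn-fromℕ n k)

-- Laplace expansion along a replaceable first row

module FirstRowExpansion (R : CommutativeRing c ℓ) where
  open CommutativeRing R hiding (zero)
  open Determinant rawRing
  open SemiringSum semiring
  open RingProperties ring using (-‿distribˡ-*; -‿distribʳ-*; -‿involutive; -1*x≈-x)
  module * = CommutativeSemigroupProperties *-commutativeSemigroup
  open SetoidReasoning setoid
  open RawSemiringDefs (RawRing.rawSemiring rawRing) using (_^_)

  sign : ∀ {n} → Fin n → Carrier
  sign j = (- 1#) ^ toℕ j

  minor : ∀ {n} → (Fin n → Fin (suc n) → Carrier) → Fin (suc n) → Carrier
  minor N j = det λ i k → N i (punchIn j k)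

  term : ∀ {n} → (Fin (suc n) → Carrier) → (Fin n → Fin (suc n) → Carrier) → Fin (suc n) → Carrier
  term r N j = sign j * r j * minor N j

  -- The first row is a separate argument so that it can be replaced while all minors stay fixed;
  -- `det M` unfolds to `expand (M zero) (λ i → M (suc i))`.
  expand : ∀ {n} → (Fin (suc n) → Carrier) → (Fin n → Fin (suc n) → Carrier) → Carrier
  expand r N = sum (term r N)

  sum-cong : ∀ {n} (f g : Fin n → Carrier) → (∀ i → f i ≈ g i) → sum f ≈ sum g
  sum-cong f g = sum-cong-≋

  sum-zero : ∀ {n} (f : Fin n → Carrier) → (∀ i → f i ≈ 0#) → sum f ≈ 0#
  sum-zero {n} f f≈0 = trans (sum-cong-≋ f≈0) (sum-replicate-zero n)

  det-cong : ∀ {n} (M N : Fin n → Fin n → Carrier) → (∀ i j → M i j ≈ N i j) → det M ≈ det N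
  det-cong {zero}  M N e = refl
  det-cong {suc n} M N e =
    sum-cong (term (M zero) (λ i → M (suc i))) (term (N zero) (λ i → N (suc i))) λ j →
      *-cong (*-congˡ {sign j} (e zero j)) (det-cong _ _ λ i k → e (suc i) (punchIn j k))

  expand-cong : ∀ {n} (r s : Fin (suc n) → Carrier) N → (∀ j → r j ≈ s j) →
    expand r N ≈ expand s N
  expand-cong r s N e =
    sum-cong (term r N) (term s N) λ j → *-congʳ {minor N j} (*-congˡ {sign j} (e j))

  expand-+ : ∀ {n} (r s : Fin (suc n) → Carrier) N →
    expand (λ j → r j + s j) N ≈ expand r N + expand s N
  expand-+ r s N = trans
    (sum-cong (term (λ j → r j + s j) N) (λ j → term r N j + term s N j) λ j →
      trans (*-congʳ {minor N j} (distribˡ (sign j) (r j) (s j))) (distribʳ _ _ _))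
    (∑-distrib-+ (term r N) (term s N))

  expand-* : ∀ {n} x (r : Fin (suc n) → Carrier) N →
    expand (λ j → x * r j) N ≈ x * expand r N
  expand-* x r N = trans
    (sum-cong (term (λ j → x * r j) N) (λ j → x * term r N j) λ j →
      trans (*-congʳ {minor N j} (*.x∙yz≈y∙xz (sign j) x (r j))) (*-assoc _ _ _))
    (sym (*-distribˡ-sum x (term r N)))

  expand-first : ∀ {n} (r : Fin (suc n) → Carrier) N → (∀ j → r (suc j) ≈ 0#) →
    expand r N ≈ r zero * minor N zero
  expand-first r N r≈0 = begin
    1# * r zero * minor N zero + sum (λ j → term r N (suc j))
      ≈⟨ +-cong (*-congʳ (*-identityˡ _)) (sum-zero (λ j → term r N (suc j)) λ j →
           trans (*-congʳ (trans (*-congˡ (r≈0 j)) (zeroʳ _))) (zeroˡ _)) ⟩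
    r zero * minor N zero + 0#
      ≈⟨ +-identityʳ _ ⟩
    r zero * minor N zero ∎

  expand-last : ∀ {n} (r : Fin (suc n) → Carrier) N → (∀ (j : Fin n) → r (inject₁ j) ≈ 0#) →
    expand r N ≈ term r N (Fin.fromℕ n)
  expand-last {n} r N r≈0 = begin
    sum (term r N)
      ≈⟨ sum-init-last (term r N) ⟩
    sum (λ j → term r N (inject₁ j)) + term r N (Fin.fromℕ n)
      ≈⟨ +-congʳ (sum-zero (λ j → term r N (inject₁ j)) λ j →
           trans (*-congʳ (trans (*-congˡ (r≈0 j)) (zeroʳ _))) (zeroˡ _)) ⟩
    0# + term r N (Fin.fromℕ n)
      ≈⟨ +-identityˡ _ ⟩
    term r N (Fin.fromℕ n) ∎

  -- (j , k) ↦ (punchIn j k , pinch k j) is the involution exchanging the two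
  -- entries of a pair of distinct columns (j , punchIn j k).
  sum-exchange : ∀ {n} (F : Fin (suc n) → Fin n → Carrier) →
    sum (λ j → sum (F j)) ≈ sum λ j → sum λ k → F (punchIn j k) (pinch k j)
  sum-exchange {zero}  F = refl
  sum-exchange {suc n} F = begin
    sum row + sum (λ j → column j + sum (rest j))
      ≈⟨ +-congˡ (∑-distrib-+ column λ j → sum (rest j)) ⟩
    sum row + (sum column + sum (λ j → sum (rest j)))
      ≈⟨ x∙yz≈y∙xz (sum row) (sum column) _ ⟩
    sum column + (sum row + sum (λ j → sum (rest j)))
      ≈⟨ +-congˡ (+-congˡ (sum-exchange rest)) ⟩
    sum column + (sum row + sum (λ j → sum (rest′ j)))
      ≈⟨ +-congˡ (∑-distrib-+ row λ j → sum (rest′ j)) ⟨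
    sum (λ j → sum λ k → F (punchIn j k) (pinch k j)) ∎
    where
    open CommutativeSemigroupProperties +-commutativeSemigroup using (x∙yz≈y∙xz)
    row      = F zero
    column   = λ j → F (suc j) zero
    rest     = λ j k → F (suc j) (suc k)
    rest′    = λ j k → rest (punchIn j k) (pinch k j)

  -- A pair `(zero , k)` cancels against its image `(suc k , zero)`, and the pairs that avoid column
  -- zero are left to the induction. Cancelling in pairs avoids passing from x + x = 0 to x = 0,
  -- which can fail in `R`.
  sum-alternating : ∀ {n} (F : Fin (suc n) → Fin n → Carrier) →
    (∀ j k → F j k + F (punchIn j k) (pinch k j) ≈ 0#) → sum (λ j → sum (F j)) ≈ 0#
  sum-alternating {zero}  F alt = +-identityʳ 0#
  sum-alternating {suc n} F alt = begin
    sum row + sum (λ j → column j + sum (rest j))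
      ≈⟨ +-congˡ (∑-distrib-+ column λ j → sum (rest j)) ⟩
    sum row + (sum column + sum (λ j → sum (rest j)))
      ≈⟨ +-assoc _ _ _ ⟨
    sum row + sum column + sum (λ j → sum (rest j))
      ≈⟨ +-cong (sym (∑-distrib-+ row column))
                (sum-alternating rest λ j k → alt (suc j) (suc k)) ⟩
    sum (λ k → row k + column k) + 0#
      ≈⟨ +-identityʳ _ ⟩
    sum (λ k → row k + column k)
      ≈⟨ sum-zero (λ k → row k + column k) (alt zero) ⟩
    0# ∎
    where
    row      = F zero
    column   = λ j → F (suc j) zero
    rest     = λ j k → F (suc j) (suc k)

  -- The indices on the left add up to j + k + 1 if j ≤ k and to j + k - 1 otherwise, because one
  -- column has moved past the other.
  sign-exchange : ∀ {n} (j : Fin (suc n)) (k : Fin n) →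
    sign (punchIn j k) * sign (pinch k j) ≈ - (sign j * sign k)
  sign-exchange {suc n} zero    k       = begin
    - 1# * sign k * 1#    ≈⟨ *-identityʳ _ ⟩
    - 1# * sign k         ≈⟨ -‿distribˡ-* 1# (sign k) ⟨
    - (1# * sign k)       ∎
  sign-exchange {suc n} (suc j) zero    = begin
    1# * sign j              ≈⟨ *-identityˡ _ ⟩
    sign j                   ≈⟨ -‿involutive (sign j) ⟨
    - (- sign j)             ≈⟨ -‿cong (-1*x≈-x (sign j)) ⟨
    - (- 1# * sign j)        ≈⟨ -‿cong (*-identityʳ _) ⟨
    - (- 1# * sign j * 1#)   ∎
  sign-exchange {suc n} (suc j) (suc k) = begin
    - 1# * sign (punchIn j k) * (- 1# * sign (pinch k j))
      ≈⟨ *.interchange (- 1#) (sign (punchIn j k)) (- 1#) (sign (pinch k j)) ⟩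
    - 1# * - 1# * (sign (punchIn j k) * sign (pinch k j))
      ≈⟨ *-congˡ (sign-exchange j k) ⟩
    - 1# * - 1# * - (sign j * sign k)
      ≈⟨ -‿distribʳ-* _ _ ⟨
    - (- 1# * - 1# * (sign j * sign k))
      ≈⟨ -‿cong (*.interchange (- 1#) (- 1#) (sign j) (sign k)) ⟩
    - (- 1# * sign j * (- 1# * sign k)) ∎

  pair-term : ∀ {n} (f g : Fin (suc (suc n)) → Carrier) (N : Fin n → Fin (suc (suc n)) → Carrier) →
    Fin (suc (suc n)) → Fin (suc n) → Carrier
  pair-term f g N j k =
    sign j * f j * (sign k * g (punchIn j k) * det λ i l → N i (punchIn j (punchIn k l)))

  -- Taking the same two columns in the other order keeps the inner minor and flips the sign, while
  -- `f` and `g` trade places.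
  pair-term-exchange : ∀ {n} f g (N : Fin n → _) j k →
    pair-term f g N (punchIn j k) (pinch k j) ≈ - pair-term g f N j k
  pair-term-exchange f g N j k = begin
    s′ * f j′ * (t′ * g (punchIn j′ (pinch k j)) * D′)
      ≈⟨ *-congˡ (*-cong (*-congˡ (reflexive (≡.cong g (punchIn-pinch j k))))
           (det-cong _ _ λ i l → reflexive (≡.cong (N i) (punchIn-comm j k l)))) ⟩
    s′ * f j′ * (t′ * g j * D)
      ≈⟨ *-assoc _ _ _ ⟨
    s′ * f j′ * (t′ * g j) * D
      ≈⟨ *-congʳ (*.interchange s′ (f j′) t′ (g j)) ⟩
    s′ * t′ * (f j′ * g j) * D
      ≈⟨ *-congʳ (*-cong (sign-exchange j k) (*-comm (f j′) (g j))) ⟩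
    - (s * t) * (g j * f j′) * D
      ≈⟨ trans (*-congʳ (sym (-‿distribˡ-* _ _))) (sym (-‿distribˡ-* _ _)) ⟩
    - (s * t * (g j * f j′) * D)
      ≈⟨ -‿cong (*-congʳ (*.interchange s t (g j) (f j′))) ⟩
    - (s * g j * (t * f j′) * D)
      ≈⟨ -‿cong (*-assoc _ _ _) ⟩
    - (s * g j * (t * f j′ * D)) ∎
    where
    j′ = punchIn j k
    s  = sign j
    t  = sign k
    s′ = sign j′
    t′ = sign (pinch k j)
    D  = det λ i l → N i (punchIn j (punchIn k l))
    D′ = det λ i l → N i (punchIn j′ (punchIn (pinch k j) l))

  expand² : ∀ {n} f (N : Fin (suc n) → _) →
    expand f N ≈ sum λ j → sum (pair-term f (N zero) (λ i → N (suc i)) j)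
  expand² f N = sum-cong (term f N) (λ j → sum (pair-term f (N zero) (λ i → N (suc i)) j)) λ j →
    *-distribˡ-sum (sign j * f j)
      (term (λ k → N zero (punchIn j k)) (λ i k → N (suc i) (punchIn j k)))

  -- If the top row is repeated directly below, the terms of the double expansion cancel in pairs. A
  -- repetition further down is reduced to a smaller matrix by exchanging the two top rows.
  expand-repeated : ∀ {n} (N : Fin n → Fin (suc n) → Carrier) i → expand (N i) N ≈ 0#
  expand-repeated {suc n} N zero = trans (expand² (N zero) N)
    (sum-alternating (pair-term (N zero) (N zero) (λ i → N (suc i))) λ j k →
      trans (+-congˡ (pair-term-exchange (N zero) (N zero) (λ i → N (suc i)) j k)) (-‿inverseʳ _))
  expand-repeated {suc n} N (suc i) = begin
    expand (N (suc i)) N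
      ≈⟨ expand² (N (suc i)) N ⟩
    sum (λ j → sum (pair-term (N (suc i)) (N zero) N′ j))
      ≈⟨ sum-exchange (pair-term (N (suc i)) (N zero) N′) ⟩
    sum (λ j → sum λ k → pair-term (N (suc i)) (N zero) N′ (punchIn j k) (pinch k j))
      ≈⟨ sum-zero (λ j → sum λ k → pair-term (N (suc i)) (N zero) N′ (punchIn j k) (pinch k j)) inner ⟩
    0# ∎
    where
    N′ = λ i → N (suc i)

    inner : ∀ j → sum (λ k → pair-term (N (suc i)) (N zero) N′ (punchIn j k) (pinch k j)) ≈ 0#
    inner j = begin
      sum (λ k → pair-term (N (suc i)) (N zero) N′ (punchIn j k) (pinch k j))
        -- With `N zero` expanded first, the inner sum is a multiple of a determinant whose top row
        -- `N″ i` recurs below.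
        ≈⟨ sum-cong _ (λ k → x * term (N″ i) N″ k) (λ k →
             trans (pair-term-exchange (N (suc i)) (N zero) N′ j k) (-‿distribˡ-* _ _)) ⟩
      sum (λ k → x * term (N″ i) N″ k)
        ≈⟨ *-distribˡ-sum x (term (N″ i) N″) ⟨
      x * expand (N″ i) N″
        ≈⟨ *-congˡ (expand-repeated N″ i) ⟩
      x * 0#
        ≈⟨ zeroʳ x ⟩
      0# ∎
      where
      x  = - (sign j * N zero j)
      N″ = λ m k → N′ m (punchIn j k)

-- Sequences over a ring with integer constants

module Sequences (R : CommutativeRing c ℓ)
  (integers : ℤ.+-*-rawRing -Raw-AlmostCommutative⟶ fromCommutativeRing R) where

  open CommutativeRing R hiding (zero)
  open _-Raw-AlmostCommutative⟶_ integers using (⟦_⟧; +-homo; *-homo; 0-homo; 1-homo)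
  open Determinant rawRing using (det; hankel)
  open FirstRowExpansion R
  open RawSemiringDefs (RawRing.rawSemiring rawRing) using (_^_)
  open SetoidReasoning setoid

  private
    _≟⟦⟧_ : WeaklyDecidable (λ i j → ⟦ i ⟧ ≈ ⟦ j ⟧)
    i ≟⟦⟧ j with i ℤ.≟ j
    ... | yes i≡j = just (reflexive (≡.cong ⟦_⟧ i≡j))
    ... | no  _   = nothing

  open RingSolver ℤ.+-*-rawRing (fromCommutativeRing R) integers _≟⟦⟧_ public
    using (solve; _:=_; _:+_; _:*_; _:-_; :-_; con)

  -- By recursion, so that ν (suc n) unfolds to an expression of the ring solver.
  ν : ℕ → Carrier
  ν zero    = ⟦ + 0 ⟧
  ν (suc n) = ⟦ + 1 ⟧ + ν n

  ν≈⟦⟧ : ∀ n → ν n ≈ ⟦ + n ⟧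
  ν≈⟦⟧ zero    = refl
  ν≈⟦⟧ (suc n) = trans (+-congˡ (ν≈⟦⟧ n)) (sym (+-homo (+ 1) (+ n)))

  ν-* : ∀ m n → ν (m ℕ.* n) ≈ ν m * ν n
  ν-* m n = begin
    ν (m ℕ.* n)         ≈⟨ ν≈⟦⟧ (m ℕ.* n) ⟩
    ⟦ + (m ℕ.* n) ⟧     ≡⟨ ≡.cong ⟦_⟧ (ℤ.pos-* m n) ⟩
    ⟦ + m ℤ.* + n ⟧     ≈⟨ *-homo (+ m) (+ n) ⟩
    ⟦ + m ⟧ * ⟦ + n ⟧   ≈⟨ *-cong (ν≈⟦⟧ m) (ν≈⟦⟧ n) ⟨
    ν m * ν n           ∎

  ν-suc-! : ∀ n → ν (suc n !) * ν (suc n !) ≈ ν (suc n) * ν (suc n) * (ν (n !) * ν (n !))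
  ν-suc-! n = trans (*-cong (ν-* (suc n) (n !)) (ν-* (suc n) (n !)))
    (solve 2 (λ n f → n :* f :* (n :* f) := n :* n :* (f :* f)) refl (ν (suc n)) (ν (n !)))

  Sequence : Set c
  Sequence = ℕ → Carrier

  -- Entry n is Σ C(n,i) a_i, built by Pascal's rule: the value at (z + 1)^n of the functional z^i ↦
  -- a_i.
  binomial : Sequence → Sequence
  binomial a zero    = a zero
  binomial a (suc n) = binomial a n + binomial (λ m → a (suc m)) n

  -- Products of exponential generating functions

  module ExponentialSeries where
    open PowerSeries R using (Series; tail; constant; _⊕_; _⊗_; _≋_; ⊗-congˡ)

    derivative : Series → Series
    derivative f n = ν (suc n) * f (suc n)

    ⊗-congʳ : ∀ f {g h} → g ≋ h → f ⊗ g ≋ f ⊗ h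
    ⊗-congʳ f e zero    = *-congˡ (e 0)
    ⊗-congʳ f e (suc n) = +-cong (*-congˡ (e (suc n))) (⊗-congʳ (tail f) e n)

    ⊗-distribˡ-⊕ : ∀ f g h → f ⊗ (g ⊕ h) ≋ (f ⊗ g) ⊕ (f ⊗ h)
    ⊗-distribˡ-⊕ f g h zero    = distribˡ _ _ _
    ⊗-distribˡ-⊕ f g h (suc n) = trans
      (+-cong (distribˡ (f 0) _ _) (⊗-distribˡ-⊕ (tail f) g h n))
      (solve 4 (λ a b c d → (a :+ b) :+ (c :+ d) := (a :+ c) :+ (b :+ d)) refl
        (f 0 * g (suc n)) (f 0 * h (suc n)) ((tail f ⊗ g) n) ((tail f ⊗ h) n))

    ⊗-distribʳ-⊕ : ∀ h f g → (f ⊕ g) ⊗ h ≋ (f ⊗ h) ⊕ (g ⊗ h)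
    ⊗-distribʳ-⊕ h f g zero    = distribʳ _ _ _
    ⊗-distribʳ-⊕ h f g (suc n) = trans
      (+-cong (distribʳ (h (suc n)) _ _) (⊗-distribʳ-⊕ h (tail f) (tail g) n))
      (solve 4 (λ a b c d → (a :+ b) :+ (c :+ d) := (a :+ c) :+ (b :+ d)) refl
        (f 0 * h (suc n)) (g 0 * h (suc n)) ((tail f ⊗ h) n) ((tail g ⊗ h) n))

    ⊗-constant : ∀ f x n → (f ⊗ constant x) n ≈ f n * x
    ⊗-constant f x zero    = refl
    ⊗-constant f x (suc n) =
      trans (+-cong (zeroʳ (f 0)) (⊗-constant (tail f) x n)) (+-identityˡ _)

    0⊗ : ∀ f n → ((λ _ → 0#) ⊗ f) n ≈ 0#
    0⊗ f zero    = zeroˡ _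
    0⊗ f (suc n) = trans (+-cong (zeroˡ _) (0⊗ f n)) (+-identityˡ 0#)

    constant-⊗ : ∀ x f n → (constant x ⊗ f) n ≈ x * f n
    constant-⊗ x f zero    = refl
    constant-⊗ x f (suc n) = trans (+-congˡ (0⊗ f n)) (+-identityʳ _)

    derivative-tail : ∀ f → tail (derivative f) ≋ derivative (tail f) ⊕ tail (tail f)
    derivative-tail f n = solve 2 (λ n x → let N = con (+ 1) :+ n in
      (con (+ 1) :+ N) :* x := N :* x :+ x) refl (ν n) (f (suc (suc n)))

    leibniz : ∀ f g → derivative (f ⊗ g) ≋ (derivative f ⊗ g) ⊕ (f ⊗ derivative g)
    leibniz f g zero    = solve 4 (λ a a′ b b′ → let N = con (+ 1) :+ con (+ 0) in
      N :* (a :* b′ :+ a′ :* b) := N :* a′ :* b :+ a :* (N :* b′)) refl (f 0) (f 1) (g 0) (g 1)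
    leibniz f g (suc n) = begin
      ν (suc (suc n)) * (f 0 * g (suc (suc n)) + (tail f ⊗ g) (suc n))
        ≈⟨ solve 4 (λ n a b h → let N = con (+ 1) :+ n ; N′ = con (+ 1) :+ N in
             N′ :* (a :* b :+ h) := h :+ a :* (N′ :* b) :+ N :* h) refl
             (ν n) (f 0) (g (suc (suc n))) ((tail f ⊗ g) (suc n)) ⟩
      (tail f ⊗ g) (suc n) + f 0 * derivative g (suc n) + derivative (tail f ⊗ g) n
        ≈⟨ +-congˡ (leibniz (tail f) g n) ⟩
      (f 1 * g (suc n) + (tail (tail f) ⊗ g) n) + f 0 * derivative g (suc n)
        + ((derivative (tail f) ⊗ g) n + (tail f ⊗ derivative g) n)
        ≈⟨ solve 6 (λ a b h c d e → (a :* b :+ h) :+ c :+ (d :+ e)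
             := ((con (+ 1) :+ con (+ 0)) :* a :* b :+ (d :+ h)) :+ (c :+ e)) refl
             (f 1) (g (suc n)) ((tail (tail f) ⊗ g) n) (f 0 * derivative g (suc n))
             ((derivative (tail f) ⊗ g) n) ((tail f ⊗ derivative g) n) ⟩
      (derivative f 0 * g (suc n) + ((derivative (tail f) ⊗ g) n + (tail (tail f) ⊗ g) n))
        + (f ⊗ derivative g) (suc n)
        ≈⟨ +-congʳ (+-congˡ (trans (⊗-congˡ g (derivative-tail f) n)
             (⊗-distribʳ-⊕ g (derivative (tail f)) (tail (tail f)) n))) ⟨
      (derivative f ⊗ g) (suc n) + (f ⊗ derivative g) (suc n) ∎

    module _ (u : Series) (u₀≈1 : u 0 ≈ 1#) (u-suc : ∀ n → ν (suc n) * u (suc n) ≈ u n)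
      (ν-cancel : ∀ n {x y} → ν (suc n) * x ≈ ν (suc n) * y → x ≈ y) where

      -- The hypotheses make `u` the series e^t: constant term 1, equal to its own derivative.
      -- Differentiating the product gives the same products for `a` and for its shift, which is
      -- Pascal's rule; `ν-cancel` then removes the factor n + 1.
      ⊗-binomial : ∀ a n → ((λ m → u m * a m) ⊗ u) n ≈ u n * binomial a n
      ⊗-binomial a zero    = trans (*-congˡ u₀≈1) (*-identityʳ _)
      ⊗-binomial a (suc n) = ν-cancel n (begin
        ν (suc n) * (f ⊗ u) (suc n)
          ≈⟨ leibniz f u n ⟩
        (derivative f ⊗ u) n + (f ⊗ derivative u) n
          ≈⟨ +-cong (⊗-congˡ u (λ m → trans (sym (*-assoc _ _ _)) (*-congʳ (u-suc m))) n)
               (⊗-congʳ f u-suc n) ⟩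
        ((λ m → u m * a (suc m)) ⊗ u) n + (f ⊗ u) n
          ≈⟨ +-cong (⊗-binomial (λ m → a (suc m)) n) (⊗-binomial a n) ⟩
        u n * binomial (λ m → a (suc m)) n + u n * binomial a n
          ≈⟨ trans (sym (distribˡ _ _ _)) (*-congˡ (+-comm _ _)) ⟩
        u n * binomial a (suc n)
          ≈⟨ *-congʳ (u-suc n) ⟨
        ν (suc n) * u (suc n) * binomial a (suc n)
          ≈⟨ *-assoc _ _ _ ⟩
        ν (suc n) * (u (suc n) * binomial a (suc n)) ∎)
        where f = λ m → u m * a m

  -- Polynomials in z act on sequences, with z acting as the shift; central k is
  -- the action of ∏_{j<k} (z - j²).
  central : ℕ → Sequence → Sequence
  central zero    a m = a m
  central (suc k) a m = central k a (suc m) - ν k * ν k * central k a m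

  -- Denominators of the Stieltjes fraction

  module WithParameter (y : Carrier) where

    A : ℕ → Carrier
    A n = (ν (suc n) - y) * (y + ν n)

    W : ℕ → Carrier
    W zero    = ⟦ + 1 ⟧
    W (suc n) = A n * W n

    moment : ℕ → Carrier
    moment zero    = ⟦ + 1 ⟧
    moment (suc k) = - A k * moment k

    -- The actions of the even and odd denominators of the Stieltjes fraction with
    -- coefficients - A 0, - 1², - A 1, - 2², …; the value of P n at z = 0 is W n.
    P Q : ℕ → Sequence → Sequence
    P zero    a j = a j
    P (suc n) a j = Q n a (suc j) + A n * P n a j
    Q zero    a j = a j
    Q (suc n) a j = P (suc n) a j + ν (suc n) * ν (suc n) * Q n a j

    P-cong : ∀ n {a b} → (∀ j → a j ≈ b j) → ∀ j → P n a j ≈ P n b j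
    Q-cong : ∀ n {a b} → (∀ j → a j ≈ b j) → ∀ j → Q n a j ≈ Q n b j
    P-cong zero    e j = e j
    P-cong (suc n) e j = +-cong (Q-cong n e (suc j)) (*-congˡ (P-cong n e j))
    Q-cong zero    e j = e j
    Q-cong (suc n) e j = +-cong (P-cong (suc n) e j) (*-congˡ (Q-cong n e j))

    P-shift : ∀ n a j → P n (λ i → a (suc i)) j ≈ P n a (suc j)
    Q-shift : ∀ n a j → Q n (λ i → a (suc i)) j ≈ Q n a (suc j)
    P-shift zero    a j = refl
    P-shift (suc n) a j = +-cong (Q-shift n a (suc j)) (*-congˡ (P-shift n a j))
    Q-shift zero    a j = refl
    Q-shift (suc n) a j = +-cong (P-shift (suc n) a j) (*-congˡ (Q-shift n a j))

    P-linear : ∀ n x a b j → P n (λ i → a i + x * b i) j ≈ P n a j + x * P n b j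
    Q-linear : ∀ n x a b j → Q n (λ i → a i + x * b i) j ≈ Q n a j + x * Q n b j
    P-linear zero    x a b j = refl
    P-linear (suc n) x a b j = trans
      (+-cong (Q-linear n x a b (suc j)) (*-congˡ (P-linear n x a b j)))
      (solve 6 (λ qa qb x A pa pb →
           (qa :+ x :* qb) :+ A :* (pa :+ x :* pb) := (qa :+ A :* pa) :+ x :* (qb :+ A :* pb))
        refl (Q n a (suc j)) (Q n b (suc j)) x (A n) (P n a j) (P n b j))
    Q-linear zero    x a b j = refl
    Q-linear (suc n) x a b j = trans
      (+-cong (P-linear (suc n) x a b j) (*-congˡ (Q-linear n x a b j)))
      (solve 6 (λ qa qb x A pa pb →
           (pa :+ x :* pb) :+ A :* (qa :+ x :* qb) := (pa :+ A :* qa) :+ x :* (pb :+ A :* qb))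
        refl (Q n a j) (Q n b j) x (ν (suc n) * ν (suc n)) (P (suc n) a j) (P (suc n) b j))

    central-shift : ∀ k a m → central k a (suc m) ≈ central (suc k) a m + ν k * ν k * central k a m
    central-shift k a m = solve 2 (λ x z → x := (x :- z) :+ z) refl (central k a (suc m)) _

    -- Since z ∏_{j<k} (z - j²) is the next such product plus k² times the present one, values at
    -- shifted arguments reduce to values at `m = 0`.
    P-central : ∀ n k a m →
      P n (central k a) (suc m) ≈ P n (central (suc k) a) m + ν k * ν k * P n (central k a) m
    P-central n k a m = begin
      P n (central k a) (suc m)                ≈⟨ P-shift n (central k a) m ⟨
      P n (λ i → central k a (suc i)) m        ≈⟨ P-cong n (central-shift k a) m ⟩
      P n (λ i → central (suc k) a i + ν k * ν k * central k a i) m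
        ≈⟨ P-linear n (ν k * ν k) (central (suc k) a) (central k a) m ⟩
      P n (central (suc k) a) m + ν k * ν k * P n (central k a) m ∎

    Q-central : ∀ n k a m →
      Q n (central k a) (suc m) ≈ Q n (central (suc k) a) m + ν k * ν k * Q n (central k a) m
    Q-central n k a m = begin
      Q n (central k a) (suc m)                ≈⟨ Q-shift n (central k a) m ⟨
      Q n (λ i → central k a (suc i)) m        ≈⟨ Q-cong n (central-shift k a) m ⟩
      Q n (λ i → central (suc k) a i + ν k * ν k * central k a i) m
        ≈⟨ Q-linear n (ν k * ν k) (central (suc k) a) (central k a) m ⟩
      Q n (central (suc k) a) m + ν k * ν k * Q n (central k a) m ∎

    -- τ n k = ∏_{i=1..n} i (i - k).
    τ : ℕ → ℕ → Carrier
    τ zero    k = ⟦ + 1 ⟧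
    τ (suc n) k = ν (suc n) * (ν (suc n) - ν k) * τ n k

    -- Both sides equal -n! ∏_{i=0..n} (i - k). The division-free form also covers k = 0 and k = n.
    τ-suc : ∀ n k → ν k * τ n k ≈ (ν k - ν n) * τ n (suc k)
    τ-suc zero    k = solve 1 (λ k → k :* con (+ 1) := (k :- con (+ 0)) :* con (+ 1)) refl (ν k)
    τ-suc (suc n) k = begin
      ν k * (ν (suc n) * (ν (suc n) - ν k) * τ n k)
        ≈⟨ solve 3 (λ k N t → k :* (N :* (N :- k) :* t) := N :* (N :- k) :* (k :* t)) refl
             (ν k) (ν (suc n)) (τ n k) ⟩
      ν (suc n) * (ν (suc n) - ν k) * (ν k * τ n k)
        ≈⟨ *-congˡ (τ-suc n k) ⟩
      ν (suc n) * (ν (suc n) - ν k) * ((ν k - ν n) * τ n (suc k))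
        ≈⟨ solve 3 (λ k n t → let N = con (+ 1) :+ n in
             N :* (N :- k) :* ((k :- n) :* t) := (k :- N) :* (N :* (N :- (con (+ 1) :+ k)) :* t))
             refl (ν k) (ν n) (τ n (suc k)) ⟩
      (ν k - ν (suc n)) * (ν (suc n) * (ν (suc n) - ν (suc k)) * τ n (suc k)) ∎

    -- The factor with i = k + 1 is zero, and it occurs because k + 1 ≤ n; the recursion searches
    -- for it from the top.
    τ-vanishes : ∀ {n k} → k < n → τ n (suc k) ≈ 0#
    τ-vanishes {suc n} {k} k<1+n with k ℕ.≟ n
    ... | yes ≡.refl = trans
      (solve 2 (λ n t → n :* (n :- n) :* t := con (+ 0)) refl (ν (suc n)) (τ n (suc k))) 0-homo
    ... | no k≢n = trans (*-congˡ (τ-vanishes (ℕ.≤∧≢⇒< (ℕ.s≤s⁻¹ k<1+n) k≢n))) (zeroʳ _)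

    -- The first factor is (-1)^n n!² and its sign cancels that of `moment n`.
    τ-moment : ∀ n → τ n (suc n) * moment n ≈ ν (n !) * ν (n !) * W n
    τ-moment zero    = solve 0
      (con (+ 1) :* con (+ 1)
        := (con (+ 1) :+ con (+ 0)) :* (con (+ 1) :+ con (+ 0)) :* con (+ 1)) refl
    τ-moment (suc n) = begin
      N * (N - ν (suc (suc n))) * τ n (suc (suc n)) * (- A n * moment n)
        -- The inserted factor `N - ν n` is 1; it brings the product into the shape required by
        -- `τ-suc`.
        ≈⟨ solve 4 (λ n A t m → let N = con (+ 1) :+ n in
             N :* (N :- (con (+ 1) :+ N)) :* t :* (:- A :* m) := N :* A :* m :* ((N :- n) :* t))
             refl (ν n) (A n) (τ n (suc (suc n))) (moment n) ⟩
      N * A n * moment n * ((N - ν n) * τ n (suc (suc n)))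
        ≈⟨ *-congˡ (τ-suc n (suc n)) ⟨
      N * A n * moment n * (N * τ n (suc n))
        ≈⟨ solve 4 (λ N A t m → N :* A :* m :* (N :* t) := N :* N :* A :* (t :* m)) refl
             N (A n) (τ n (suc n)) (moment n) ⟩
      N * N * A n * (τ n (suc n) * moment n)
        ≈⟨ *-congˡ (τ-moment n) ⟩
      N * N * A n * (ν (n !) * ν (n !) * W n)
        ≈⟨ solve 4 (λ N A F W → N :* N :* A :* (F :* W) := N :* N :* F :* (A :* W)) refl
             N (A n) (ν (n !) * ν (n !)) (W n) ⟩
      N * N * (ν (n !) * ν (n !)) * (A n * W n)
        ≈⟨ *-congʳ (ν-suc-! n) ⟨
      ν (suc n !) * ν (suc n !) * W (suc n) ∎
      where N = ν (suc n)

    τ-zero : ∀ n → τ n 0 ≈ ν (n !) * ν (n !)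
    τ-zero zero    = solve 0
      (con (+ 1) := (con (+ 1) :+ con (+ 0)) :* (con (+ 1) :+ con (+ 0))) refl
    τ-zero (suc n) = begin
      ν (suc n) * (ν (suc n) - ν 0) * τ n 0
        ≈⟨ *-cong (solve 1 (λ N → N :* (N :- con (+ 0)) := N :* N) refl (ν (suc n))) (τ-zero n) ⟩
      ν (suc n) * ν (suc n) * (ν (n !) * ν (n !))
        ≈⟨ ν-suc-! n ⟨
      ν (suc n !) * ν (suc n !) ∎

    -- Orthogonality of the denominators

    module WithMoments (a : Sequence) (central≈moment : ∀ k → central k a 0 ≈ moment k) where

      -- The two closed forms support each other: `P (suc n)` needs `Q n` at k and at k + 1, and
      -- `Q (suc n)` needs the new `P`. Working in the basis ∏_{j<k} (z - j²) makes every value a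
      -- single product.
      P-moment : ∀ n k → P n (central k a) 0 ≈ τ n (suc k) * moment k
      Q-moment : ∀ n k → Q n (central k a) 0 ≈ τ n k * moment k
      P-moment zero    k = trans (central≈moment k)
        (solve 1 (λ m → m := con (+ 1) :* m) refl (moment k))
      P-moment (suc n) k = begin
        Q n (central k a) 1 + A n * P n (central k a) 0
          ≈⟨ +-cong (Q-central n k a 0) refl ⟩
        Q n (central (suc k) a) 0 + ν k * ν k * Q n (central k a) 0 + A n * P n (central k a) 0
          ≈⟨ +-cong (+-cong (Q-moment n (suc k)) (*-congˡ (Q-moment n k))) (*-congˡ (P-moment n k)) ⟩
        τ n (suc k) * (- A k * moment k) + ν k * ν k * (τ n k * moment k) + A n * (τ n (suc k) * moment k)
          ≈⟨ solve 6 (λ y k n t′ t m → let A = λ n → (con (+ 1) :+ n :- y) :* (y :+ n) in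
               t′ :* (:- A k :* m) :+ k :* k :* (t :* m) :+ A n :* (t′ :* m)
               := (A n :- A k) :* t′ :* m :+ k :* m :* (k :* t))
               refl y (ν k) (ν n) (τ n (suc k)) (τ n k) (moment k) ⟩
        (A n - A k) * τ n (suc k) * moment k + ν k * moment k * (ν k * τ n k)
          ≈⟨ +-congˡ (*-congˡ (τ-suc n k)) ⟩
        (A n - A k) * τ n (suc k) * moment k + ν k * moment k * ((ν k - ν n) * τ n (suc k))
          -- Here `A n - A k` is (n - k)(n + k + 1), free of `y`; adding k(k - n) leaves (n - k)(n +
          -- 1), the new factor of `τ`.
          ≈⟨ solve 5 (λ y k n t′ m →
               let A = λ n → (con (+ 1) :+ n :- y) :* (y :+ n)
                   N = con (+ 1) :+ n in
               (A n :- A k) :* t′ :* m :+ k :* m :* ((k :- n) :* t′)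
               := N :* (N :- (con (+ 1) :+ k)) :* t′ :* m)
               refl y (ν k) (ν n) (τ n (suc k)) (moment k) ⟩
        τ (suc n) (suc k) * moment k ∎
      Q-moment zero    k = P-moment zero k
      Q-moment (suc n) k = begin
        P (suc n) (central k a) 0 + ν (suc n) * ν (suc n) * Q n (central k a) 0
          ≈⟨ +-cong (P-moment (suc n) k) (*-congˡ (Q-moment n k)) ⟩
        τ (suc n) (suc k) * moment k + ν (suc n) * ν (suc n) * (τ n k * moment k)
          ≈⟨ solve 5 (λ k n t′ t m → let N = con (+ 1) :+ n in
               N :* (N :- (con (+ 1) :+ k)) :* t′ :* m :+ N :* N :* (t :* m)
               := N :* m :* (N :* t :- (k :- n) :* t′))
               refl (ν k) (ν n) (τ n (suc k)) (τ n k) (moment k) ⟩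
        ν (suc n) * moment k * (ν (suc n) * τ n k - (ν k - ν n) * τ n (suc k))
          ≈⟨ *-congˡ (+-congˡ (-‿cong (τ-suc n k))) ⟨
        ν (suc n) * moment k * (ν (suc n) * τ n k - ν k * τ n k)
          ≈⟨ solve 4 (λ k n t m → let N = con (+ 1) :+ n in
               N :* m :* (N :* t :- k :* t) := N :* (N :- k) :* t :* m)
               refl (ν k) (ν n) (τ n k) (moment k) ⟩
        τ (suc n) k * moment k ∎

      -- The argument stands for z^m ∏_{j<k} (z - j²), of degree k + m. Shifts are traded for larger
      -- k without raising this degree, and at `m = 0` the value contains a zero factor of `τ`.
      P-orthogonal : ∀ n k m → k ℕ.+ m < n → P n (central k a) m ≈ 0#
      P-orthogonal n k zero    k+m<n = trans (P-moment n k) (trans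
        (*-congʳ (τ-vanishes (≡.subst (_< n) (ℕ.+-identityʳ k) k+m<n))) (zeroˡ _))
      P-orthogonal n k (suc m) k+m<n = begin
        P n (central k a) (suc m)
          ≈⟨ P-central n k a m ⟩
        P n (central (suc k) a) m + ν k * ν k * P n (central k a) m
          ≈⟨ +-cong (P-orthogonal n (suc k) m 1+k+m<n)
               (trans (*-congˡ (P-orthogonal n k m (ℕ.<⇒≤ 1+k+m<n))) (zeroʳ _)) ⟩
        0# + 0#  ≈⟨ +-identityˡ 0# ⟩
        0#       ∎
        where 1+k+m<n = ≡.subst (_< n) (ℕ.+-suc k m) k+m<n

      -- z^m ∏_{j<k} (z - j²) and ∏_{j<n} (z - j²) are both monic of degree n, so they differ by
      -- terms orthogonal to `P n`.
      P-norm : ∀ n k m → k ℕ.+ m ≡ n → P n (central k a) m ≈ P n (central n a) 0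
      P-norm n k zero    k+m≡n = reflexive (≡.cong (λ k → P n (central k a) 0)
        (≡.trans (≡.sym (ℕ.+-identityʳ k)) k+m≡n))
      P-norm n k (suc m) k+m≡n = begin
        P n (central k a) (suc m)
          ≈⟨ P-central n k a m ⟩
        P n (central (suc k) a) m + ν k * ν k * P n (central k a) m
          ≈⟨ +-cong (P-norm n (suc k) m 1+k+m≡n)
               (trans (*-congˡ (P-orthogonal n k m (ℕ.≤-reflexive 1+k+m≡n))) (zeroʳ _)) ⟩
        P n (central n a) 0 + 0#  ≈⟨ +-identityʳ _ ⟩
        P n (central n a) 0       ∎
        where 1+k+m≡n = ≡.trans (≡.sym (ℕ.+-suc k m)) k+m≡n

      P-diagonal : ∀ n → P n a n ≈ ν (n !) * ν (n !) * W n
      P-diagonal n = trans (P-norm n 0 n ≡.refl) (trans (P-moment n n) (τ-moment n))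

      Q-first : ∀ n → Q n a 0 ≈ ν (n !) * ν (n !)
      Q-first n = trans (Q-moment n 0) (trans (*-cong (τ-zero n) 1-homo) (*-identityʳ _))

    -- Row combinations in a Hankel matrix

    module HankelRows (a : Sequence) (n : ℕ) where

      rows : Fin n → Fin (suc n) → Carrier
      rows i j = a (suc (toℕ i) ℕ.+ toℕ j)

      -- `Φ a` unfolds to `hankel n a`, so a combination of rows put in the first place is compared
      -- with the original determinant by linearity.
      Φ : Sequence → Carrier
      Φ r = expand {n} (λ j → r (toℕ j)) rows

      Φ-linear : ∀ x r s → Φ (λ j → r j + x * s j) ≈ Φ r + x * Φ s
      Φ-linear x r s = trans (expand-+ (λ j → r (toℕ j)) (λ j → x * s (toℕ j)) rows)
        (+-congˡ (expand-* x (λ j → s (toℕ j)) rows))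

      Φ-shift : ∀ i → suc i ≤ n → Φ (λ j → a (suc i ℕ.+ j)) ≈ 0#
      Φ-shift i i<n = trans
        (expand-cong _ (rows (fromℕ< i<n)) rows λ j → reflexive
          (≡.cong (λ i → a (suc i ℕ.+ toℕ j)) (≡.sym (Fin.toℕ-fromℕ< i<n))))
        (expand-repeated rows (fromℕ< i<n))

      -- z^(i+1) P_m involves only the powers z^(i+1), ..., z^(i+1+m). The bound keeps all of them
      -- among the rows 1 to n, which are already present in `rows`.
      Φ-P-shift : ∀ m i → suc i ℕ.+ m ≤ n → Φ (λ j → P m a (suc i ℕ.+ j)) ≈ 0#
      Φ-Q-shift : ∀ m i → suc i ℕ.+ m ≤ n → Φ (λ j → Q m a (suc i ℕ.+ j)) ≈ 0#
      Φ-P-shift zero    i i+m≤n = Φ-shift i (≡.subst (_≤ n) (ℕ.+-identityʳ (suc i)) i+m≤n)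
      Φ-P-shift (suc m) i i+m≤n = begin
        Φ (λ j → Q m a (suc (suc i) ℕ.+ j) + A m * P m a (suc i ℕ.+ j))
          ≈⟨ Φ-linear (A m) (λ j → Q m a (suc (suc i) ℕ.+ j)) (λ j → P m a (suc i ℕ.+ j)) ⟩
        Φ (λ j → Q m a (suc (suc i) ℕ.+ j)) + A m * Φ (λ j → P m a (suc i ℕ.+ j))
          ≈⟨ +-cong (Φ-Q-shift m (suc i) 1+i+m≤n)
               (trans (*-congˡ (Φ-P-shift m i (ℕ.<⇒≤ 1+i+m≤n))) (zeroʳ _)) ⟩
        0# + 0#  ≈⟨ +-identityˡ 0# ⟩
        0#       ∎
        where 1+i+m≤n = ≡.subst (_≤ n) (ℕ.+-suc (suc i) m) i+m≤n
      Φ-Q-shift zero    i i+m≤n = Φ-P-shift zero i i+m≤n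
      Φ-Q-shift (suc m) i i+m≤n = begin
        Φ (λ j → P (suc m) a (suc i ℕ.+ j) + ν (suc m) * ν (suc m) * Q m a (suc i ℕ.+ j))
          ≈⟨ Φ-linear _ (λ j → P (suc m) a (suc i ℕ.+ j)) (λ j → Q m a (suc i ℕ.+ j)) ⟩
        Φ (λ j → P (suc m) a (suc i ℕ.+ j)) + ν (suc m) * ν (suc m) * Φ (λ j → Q m a (suc i ℕ.+ j))
          ≈⟨ +-cong (Φ-P-shift (suc m) i i+m≤n)
               (trans (*-congˡ (Φ-Q-shift m i (ℕ.<⇒≤ 1+i+m≤n))) (zeroʳ _)) ⟩
        0# + 0#  ≈⟨ +-identityˡ 0# ⟩
        0#       ∎
        where 1+i+m≤n = ≡.subst (_≤ n) (ℕ.+-suc (suc i) m) i+m≤n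

      -- Apart from its constant term `W m`, the polynomial P_m is divisible by z and contributes
      -- only repeated rows.
      Φ-P : ∀ m → m ≤ n → Φ (P m a) ≈ W m * Φ a
      Φ-P zero    _   = trans (sym (*-identityˡ _)) (*-congʳ (sym 1-homo))
      Φ-P (suc m) m<n = begin
        Φ (λ j → Q m a (1 ℕ.+ j) + A m * P m a j)
          ≈⟨ Φ-linear (A m) (λ j → Q m a (1 ℕ.+ j)) (P m a) ⟩
        Φ (λ j → Q m a (1 ℕ.+ j)) + A m * Φ (P m a)
          ≈⟨ +-cong (Φ-Q-shift m 0 m<n) (*-congˡ (Φ-P m (ℕ.<⇒≤ m<n))) ⟩
        0# + A m * (W m * Φ a)
          ≈⟨ trans (+-identityˡ _) (sym (*-assoc _ _ _)) ⟩
        A m * W m * Φ a ∎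

      W*hankel : W n * hankel n a ≈ Φ (P n a)
      W*hankel = sym (Φ-P n ℕ.≤-refl)

    -- Hankel determinants of a sequence and of its right shift

    module Shifted (a b : Sequence) (b-zero : b 0 ≈ 0#) (b-suc : ∀ k → b (suc k) ≈ a k)
      (central≈moment : ∀ k → central k a 0 ≈ moment k) where

      open WithMoments a central≈moment

      -- As `b` is the right shift of `a`, this is L((P_n - P_n(0))/z), the value at 0 of the
      -- numerator polynomial associated with P_n.
      M : ℕ → Carrier
      M n = P n b 0

      P-b-suc : ∀ n j → P n b (suc j) ≈ P n a j
      P-b-suc n j = trans (sym (P-shift n b j)) (P-cong n b-suc j)

      Q-b-suc : ∀ n j → Q n b (suc j) ≈ Q n a j
      Q-b-suc n j = trans (sym (Q-shift n b j)) (Q-cong n b-suc j)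

      M-suc : ∀ n → M (suc n) ≈ ν (n !) * ν (n !) + A n * M n
      M-suc n = +-congʳ (trans (Q-b-suc n 0) (Q-first n))

      shiftedHankel : ℕ → Carrier
      shiftedHankel n = det {n} λ i j → a (suc (toℕ i) ℕ.+ toℕ j)

      -- After its first entry the new row consists of the values `P n a j` with j < n, which are
      -- zero by orthogonality.
      W*hankel-b : ∀ n → W n * hankel n b ≈ M n * shiftedHankel n
      W*hankel-b n = begin
        W n * hankel n b
          ≈⟨ HankelRows.W*hankel b n ⟩
        expand (λ j → P n b (toℕ j)) rows
          ≈⟨ expand-first {n} (λ j → P n b (toℕ j)) rows (λ j → trans (P-b-suc n (toℕ j))
               (P-orthogonal n 0 (toℕ j) (Fin.toℕ<n j))) ⟩
        M n * minor rows zero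
          ≈⟨ *-congˡ (det-cong {n} (λ i k → rows i (suc k)) (λ i j → a (suc (toℕ i) ℕ.+ toℕ j)) λ i k →
               trans (b-suc (toℕ i ℕ.+ suc (toℕ k)))
               (reflexive (≡.cong a (ℕ.+-suc (toℕ i) (toℕ k))))) ⟩
        M n * shiftedHankel n ∎
        where open HankelRows b n using (rows)

      -- Now only the last entry survives, and deleting the last column leaves the same minor as
      -- deleting the first column does for `b`.
      W*hankel-a : ∀ n → W n * hankel n a ≈ (- 1#) ^ n * (ν (n !) * ν (n !) * W n) * shiftedHankel n
      W*hankel-a n = begin
        W n * hankel n a
          ≈⟨ HankelRows.W*hankel a n ⟩
        expand (λ j → P n a (toℕ j)) rows
          ≈⟨ expand-last (λ j → P n a (toℕ j)) rows (λ j → P-orthogonal n 0 _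
               (≡.subst (_< n) (≡.sym (Fin.toℕ-inject₁ j)) (Fin.toℕ<n j))) ⟩
        (- 1#) ^ toℕ (Fin.fromℕ n) * P n a (toℕ (Fin.fromℕ n)) * minor rows (Fin.fromℕ n)
          ≡⟨ ≡.cong (λ m → (- 1#) ^ m * P n a m * minor rows (Fin.fromℕ n)) (Fin.toℕ-fromℕ n) ⟩
        (- 1#) ^ n * P n a n * minor rows (Fin.fromℕ n)
          ≈⟨ *-cong (*-congˡ (P-diagonal n)) (det-cong {n} _ _ λ i k →
               reflexive (≡.cong (λ k → a (suc (toℕ i) ℕ.+ k)) (toℕ-punchIn-fromℕ n k))) ⟩
        (- 1#) ^ n * (ν (n !) * ν (n !) * W n) * shiftedHankel n ∎
        where open HankelRows a n using (rows)

    -- Translation z ↦ z + 1 and the moments of the even-indexed terms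

    -- The action of z + x.
    S+ : Carrier → Sequence → Sequence
    S+ x a n = a (suc n) + x * a n

    S+-cong : ∀ x {a b} → (∀ n → a n ≈ b n) → ∀ n → S+ x a n ≈ S+ x b n
    S+-cong x e n = +-cong (e (suc n)) (*-congˡ (e n))

    S+-congˡ : ∀ {x z} a → x ≈ z → ∀ n → S+ x a n ≈ S+ z a n
    S+-congˡ a e n = +-congˡ (*-congʳ e)

    S+-+ : ∀ x a b n → S+ x (λ m → a m + b m) n ≈ S+ x a n + S+ x b n
    S+-+ x a b n = solve 5 (λ x a a′ b b′ → (a′ :+ b′) :+ x :* (a :+ b) := (a′ :+ x :* a) :+ (b′ :+ x :* b))
      refl x (a n) (a (suc n)) (b n) (b (suc n))

    S+-comm : ∀ x z a n → S+ x (S+ z a) n ≈ S+ z (S+ x a) n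
    S+-comm x z a n = solve 5 (λ x z a a′ a″ →
        (a″ :+ z :* a′) :+ x :* (a′ :+ z :* a) := (a″ :+ x :* a′) :+ z :* (a′ :+ x :* a))
      refl x z (a n) (a (suc n)) (a (suc (suc n)))

    binomial-linear : ∀ x a b n → binomial (λ m → a m + x * b m) n ≈ binomial a n + x * binomial b n
    binomial-linear x a b zero    = refl
    binomial-linear x a b (suc n) = trans
      (+-cong (binomial-linear x a b n) (binomial-linear x (λ m → a (suc m)) (λ m → b (suc m)) n))
      (solve 5 (λ x a a′ b b′ → (a :+ x :* b) :+ (a′ :+ x :* b′) := (a :+ a′) :+ x :* (b :+ b′))
        refl x (binomial a n) _ (binomial b n) _)

    -- The binomial transform substitutes z + 1 for z, which turns the factor z + x into z + 1 + x.
    S+-binomial : ∀ x a n → S+ x (binomial a) n ≈ binomial (S+ (⟦ + 1 ⟧ + x) a) n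
    S+-binomial x a n = sym (trans (binomial-linear (⟦ + 1 ⟧ + x) (λ m → a (suc m)) a n)
      (solve 3 (λ x a a′ → a′ :+ (con (+ 1) :+ x) :* a := (a :+ a′) :+ x :* a)
        refl x (binomial a n) (binomial (λ m → a (suc m)) n)))

    -- The actions of p_k(z) = ∏_{i=1..k} (z - i)(z + i - 1), of p_k(z + 1), and of
    -- o_k(z) = z ∏_{i=1..k} (z² - i²).
    p p′ o : ℕ → Sequence → Sequence
    p  zero    a = a
    p  (suc k) a = S+ (- ν (suc k)) (S+ (ν k) (p k a))
    p′ zero    a = a
    p′ (suc k) a = S+ (⟦ + 1 ⟧ + - ν (suc k)) (S+ (⟦ + 1 ⟧ + ν k) (p′ k a))
    o  zero    a n = a (suc n)
    o  (suc k) a = S+ (- ν (suc k)) (S+ (ν (suc k)) (o k a))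

    p-cong : ∀ k {a b} → (∀ n → a n ≈ b n) → ∀ n → p k a n ≈ p k b n
    p-cong zero    e = e
    p-cong (suc k) e = S+-cong _ (S+-cong _ (p-cong k e))

    p-+ : ∀ k a b n → p k (λ m → a m + b m) n ≈ p k a n + p k b n
    p-+ zero    a b n = refl
    p-+ (suc k) a b n = trans (S+-cong _ (S+-cong _ (p-+ k a b)) n)
      (trans (S+-cong _ (S+-+ _ (p k a) (p k b)) n) (S+-+ _ (S+ _ (p k a)) (S+ _ (p k b)) n))

    binomial-cong : ∀ {a b} → (∀ n → a n ≈ b n) → ∀ n → binomial a n ≈ binomial b n
    binomial-cong e zero    = e zero
    binomial-cong e (suc n) = +-cong (binomial-cong e n) (binomial-cong (λ m → e (suc m)) n)

    p-binomial : ∀ k a n → p k (binomial a) n ≈ binomial (p′ k a) n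
    p-binomial zero    a n = refl
    p-binomial (suc k) a n = begin
      S+ (- ν (suc k)) (S+ (ν k) (p k (binomial a))) n
        ≈⟨ S+-cong _ (S+-cong _ (p-binomial k a)) n ⟩
      S+ (- ν (suc k)) (S+ (ν k) (binomial (p′ k a))) n
        ≈⟨ S+-cong _ (S+-binomial (ν k) (p′ k a)) n ⟩
      S+ (- ν (suc k)) (binomial (S+ (⟦ + 1 ⟧ + ν k) (p′ k a))) n
        ≈⟨ S+-binomial (- ν (suc k)) (S+ (⟦ + 1 ⟧ + ν k) (p′ k a)) n ⟩
      binomial (p′ (suc k) a) n ∎

    -- p_{k+1}(z) = ∏_{i=1..k+1} (z - i) ∏_{i=0..k} (z + i), and all factors except z - (k + 1) form
    -- o_k(z).
    p≈o : ∀ k a n → p (suc k) a n ≈ S+ (- ν (suc k)) (o k a) n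
    p≈o zero    a n = S+-cong _ (λ n → solve 2 (λ a b → a :+ con (+ 0) :* b := a) refl (a (suc n)) (a n)) n
    p≈o (suc k) a n = S+-cong _ (λ n → trans (S+-cong _ (p≈o k a) n)
      (S+-comm (ν (suc k)) (- ν (suc k)) (o k a) n)) n

    -- After translation the unpaired factor is z + (k + 1). Together with `p≈o` this gives
    -- p_{k+1}(z) + p_{k+1}(z + 1) = 2 z o_k(z), a polynomial in z².
    p′≈o : ∀ k a n → p′ (suc k) a n ≈ S+ (ν (suc k)) (o k a) n
    p′≈o zero    a n = solve 3 (λ a a′ a″ →
        let N = con (+ 1) :+ con (+ 0) in
        (a″ :+ N :* a′) :+ (con (+ 1) :+ :- N) :* (a′ :+ N :* a) := a″ :+ N :* a′)
      refl (a n) (a (suc n)) (a (suc (suc n)))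
    p′≈o (suc k) a n = begin
      S+ (⟦ + 1 ⟧ + - ν (suc (suc k))) (S+ (ν (suc (suc k))) (p′ (suc k) a)) n
        ≈⟨ S+-congˡ (S+ (ν (suc (suc k))) (p′ (suc k) a))
             (solve 1 (λ N → con (+ 1) :+ :- (con (+ 1) :+ N) := :- N) refl (ν (suc k))) n ⟩
      S+ (- ν (suc k)) (S+ (ν (suc (suc k))) (p′ (suc k) a)) n
        ≈⟨ S+-comm (- ν (suc k)) (ν (suc (suc k))) (p′ (suc k) a) n ⟩
      S+ (ν (suc (suc k))) (S+ (- ν (suc k)) (p′ (suc k) a)) n
        ≈⟨ S+-cong _ (S+-cong _ (p′≈o k a)) n ⟩
      S+ (ν (suc (suc k))) (o (suc k) a) n ∎

    -- A geometric sequence of ratio `y` is an eigenvector of the shift, so p_k acts on it as the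
    -- scalar p_k(y) = ∏_{j<k} (-A_j).
    p-power : ∀ k x n → p k (λ m → x * y ^ m) n ≈ moment k * (x * y ^ n)
    p-power zero    x n = trans (sym (*-identityˡ _)) (*-congʳ (sym 1-homo))
    p-power (suc k) x n = trans (S+-cong _ (S+-cong _ (p-power k x)) n)
      (solve 5 (λ y k m x z →
          let N = con (+ 1) :+ k
              t = λ z → m :* (x :* z)
              u = λ z → t (y :* z) :+ k :* t z in
          u (y :* z) :+ :- N :* u z := :- ((N :- y) :* (y :+ k)) :* m :* (x :* z))
        refl y (ν k) (moment k) x (y ^ n))

    module EvenPart (η : Sequence) (functional : ∀ n → η n + binomial η n ≈ ⟦ + 2 ⟧ * y ^ n)
      (2-cancel : ∀ x z → ⟦ + 2 ⟧ * x ≈ ⟦ + 2 ⟧ * z → x ≈ z) where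

      even : Sequence
      even m = η (2 ℕ.* m)

      -- One shift of `even` is two shifts of `η`, so z - j² becomes z² - j², and ∏_{j=0..k} (z² -
      -- j²) = z o_k(z).
      central-even : ∀ k m → central (suc k) even m ≈ o k η (suc (2 ℕ.* m))
      central-even zero    m = trans
        (solve 2 (λ a b → a :- con (+ 0) :* con (+ 0) :* b := a) refl (even (suc m)) (even m))
        (reflexive (≡.cong η (ℕ.*-suc 2 m)))
      central-even (suc k) m = begin
        central (suc k) even (suc m) - N * N * central (suc k) even m
          ≈⟨ +-cong (central-even k (suc m)) (-‿cong (*-congˡ (central-even k m))) ⟩
        o k η (suc (2 ℕ.* suc m)) - N * N * o k η (suc (2 ℕ.* m))
          ≡⟨ ≡.cong (λ i → o k η (suc i) - N * N * o k η (suc (2 ℕ.* m))) (ℕ.*-suc 2 m) ⟩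
        o k η (suc (suc (suc (2 ℕ.* m)))) - N * N * o k η (suc (2 ℕ.* m))
          ≈⟨ solve 4 (λ N a b c → c :- N :* N :* a := (c :+ N :* b) :+ :- N :* (b :+ N :* a)) refl
               N (o k η (suc (2 ℕ.* m))) (o k η (suc (suc (2 ℕ.* m)))) (o k η (suc (suc (suc (2 ℕ.* m))))) ⟩
        o (suc k) η (suc (2 ℕ.* m)) ∎
        where N = ν (suc k)

      central-even≈moment : ∀ k → central k even 0 ≈ moment k
      central-even≈moment zero    = 2-cancel _ _ (begin
        ⟦ + 2 ⟧ * η 0            ≈⟨ solve 1 (λ a → con (+ 2) :* a := a :+ a) refl (η 0) ⟩
        η 0 + η 0                ≈⟨ functional 0 ⟩
        ⟦ + 2 ⟧ * 1#             ≈⟨ *-congˡ 1-homo ⟨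
        ⟦ + 2 ⟧ * ⟦ + 1 ⟧        ∎)
      central-even≈moment (suc k) = 2-cancel _ _ (begin
        ⟦ + 2 ⟧ * central (suc k) even 0
          ≈⟨ *-congˡ (central-even k 0) ⟩
        ⟦ + 2 ⟧ * o k η 1
          -- 2 z o_k is split as (z - k - 1) o_k + (z + k + 1) o_k, a polynomial plus its translate,
          -- to which `functional` applies.
          ≈⟨ solve 3 (λ N a b → con (+ 2) :* b := (b :+ :- N :* a) :+ (b :+ N :* a)) refl
               (ν (suc k)) (o k η 0) (o k η 1) ⟩
        S+ (- ν (suc k)) (o k η) 0 + S+ (ν (suc k)) (o k η) 0
          ≈⟨ +-cong (p≈o k η 0) (p′≈o k η 0) ⟨
        p (suc k) η 0 + p′ (suc k) η 0
          ≈⟨ +-congˡ (p-binomial (suc k) η 0) ⟨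
        p (suc k) η 0 + p (suc k) (binomial η) 0
          ≈⟨ p-+ (suc k) η (binomial η) 0 ⟨
        p (suc k) (λ n → η n + binomial η n) 0
          ≈⟨ p-cong (suc k) functional 0 ⟩
        p (suc k) (λ n → ⟦ + 2 ⟧ * y ^ n) 0
          ≈⟨ p-power (suc k) ⟦ + 2 ⟧ 0 ⟩
        moment (suc k) * (⟦ + 2 ⟧ * 1#)
          ≈⟨ trans (*-congˡ (*-identityʳ _)) (*-comm _ _) ⟩
        ⟦ + 2 ⟧ * moment (suc k) ∎)

-- From a recurrence to partial sums of products

module Convergents (R : CommutativeRing c ℓ) where
  open CommutativeRing R hiding (zero)
  open RawSemiringDefs (RawRing.rawSemiring rawRing) using (sum; product)
  open SemiringSolver commutativeSemiring using (solve; _:=_; _:+_; _:*_)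
  open SetoidReasoning setoid

  sum-snoc : ∀ (f : ℕ → Carrier) k →
    sum {suc k} (λ j → f (toℕ j)) ≈ sum {k} (λ j → f (toℕ j)) + f k
  sum-snoc f zero    = +-comm (f 0) 0#
  sum-snoc f (suc k) = trans (+-congˡ (sum-snoc (λ i → f (suc i)) k)) (sym (+-assoc _ _ _))

  product-snoc : ∀ (f : ℕ → Carrier) k →
    product {suc k} (λ j → f (toℕ j)) ≈ product {k} (λ j → f (toℕ j)) * f k
  product-snoc f zero    = *-comm (f 0) 1#
  product-snoc f (suc k) = trans (*-congˡ (product-snoc (λ i → f (suc i)) k)) (sym (*-assoc _ _ _))

  partialProduct : (ℕ → Carrier) → ℕ → Carrier
  partialProduct φ k = product {k} λ i → φ (suc (toℕ i))

  partialSum : (ℕ → Carrier) → ℕ → Carrier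
  partialSum φ k = 1# + sum {k} λ j → partialProduct φ (suc (toℕ j))

  module _ (a φ g w m : ℕ → Carrier)
    (w₁ : w 1 ≈ a 0) (w-suc : ∀ k → w (suc (suc k)) ≈ a (suc k) * w (suc k))
    (m₁ : m 1 ≈ 1#) (m-suc : ∀ k → m (suc (suc k)) ≈ g (suc k) + a (suc k) * m (suc k))
    (g₀ : g 0 ≈ 1#) (g-suc : ∀ k → g (suc k) ≈ a (suc k) * φ (suc k) * g k) where

    -- By `g-suc`, each product a φ is the ratio of consecutive terms of `g`, so multiplying by `w`
    -- clears the partial product.
    w*partialProduct : ∀ k → w (suc k) * partialProduct φ k ≈ a 0 * g k
    w*partialProduct zero    = *-cong w₁ (sym g₀)
    w*partialProduct (suc k) = begin
      w (suc (suc k)) * partialProduct φ (suc k)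
        ≈⟨ *-cong (w-suc k) (product-snoc (λ i → φ (suc i)) k) ⟩
      a (suc k) * w (suc k) * (partialProduct φ k * φ (suc k))
        ≈⟨ solve 4 (λ a w p f → a :* w :* (p :* f) := (w :* p) :* (a :* f)) refl
             (a (suc k)) (w (suc k)) (partialProduct φ k) (φ (suc k)) ⟩
      w (suc k) * partialProduct φ k * (a (suc k) * φ (suc k))
        ≈⟨ *-congʳ (w*partialProduct k) ⟩
      a 0 * g k * (a (suc k) * φ (suc k))
        ≈⟨ trans (*-assoc _ _ _) (*-congˡ (*-comm _ _)) ⟩
      a 0 * (a (suc k) * φ (suc k) * g k)
        ≈⟨ *-congˡ (g-suc k) ⟨
      a 0 * g (suc k) ∎

    -- Dividing `m-suc` by w_{k+2} makes m/w telescope, with increments g_{k+1}/w_{k+2}; multiplied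
    -- by a_0 these are the partial products. The statement is kept free of division.
    a₀*m : ∀ k → a 0 * m (suc k) ≈ w (suc k) * partialSum φ k
    a₀*m zero    = begin
      a 0 * m 1         ≈⟨ *-cong (sym w₁) m₁ ⟩
      w 1 * 1#          ≈⟨ *-congˡ (+-identityʳ 1#) ⟨
      w 1 * (1# + 0#)   ∎
    a₀*m (suc k) = begin
      a 0 * m (suc (suc k))
        ≈⟨ *-congˡ (m-suc k) ⟩
      a 0 * (g (suc k) + a (suc k) * m (suc k))
        ≈⟨ solve 4 (λ a₀ g a m → a₀ :* (g :+ a :* m) := a :* (a₀ :* m) :+ a₀ :* g) refl
             (a 0) (g (suc k)) (a (suc k)) (m (suc k)) ⟩
      a (suc k) * (a 0 * m (suc k)) + a 0 * g (suc k)
        ≈⟨ +-cong (*-congˡ (a₀*m k)) (sym (w*partialProduct (suc k))) ⟩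
      a (suc k) * (w (suc k) * partialSum φ k) + w (suc (suc k)) * partialProduct φ (suc k)
        ≈⟨ +-congʳ (trans (sym (*-assoc _ _ _)) (*-congʳ (sym (w-suc k)))) ⟩
      w (suc (suc k)) * partialSum φ k + w (suc (suc k)) * partialProduct φ (suc k)
        ≈⟨ distribˡ _ _ _ ⟨
      w (suc (suc k)) * (partialSum φ k + partialProduct φ (suc k))
        ≈⟨ *-congˡ (trans (+-congˡ (sum-snoc (λ j → partialProduct φ (suc j)) k)) (sym (+-assoc _ _ _))) ⟨
      w (suc (suc k)) * partialSum φ (suc k) ∎

-- Elimination of the common minor

module Combination (R : CommutativeRing c ℓ) where
  open CommutativeRing R hiding (zero)
  open RingProperties ring using (-‿distribˡ-*; -‿involutive; -1*x≈-x)
  open SemiringSolver commutativeSemiring using (solve; _:=_; _:*_)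
  open SetoidReasoning setoid

  -- `x` and `y` are the two Hankel determinants, `h` their common minor, `s` the sign (-1)^(n-1)
  -- and `q` the fraction 4/(g d). Multiplying through by w g d allows `h` to be removed without
  -- inverting anything.
  hankel-ratio : ∀ {w g d h m a k q s x y z} →
    w * x ≈ m * h → w * y ≈ - 1# * s * (g * w) * h →
    g * d * q ≈ z → a * m ≈ w * k → z * a ≈ - d → s * s ≈ 1# →
    w * (g * d) * x ≈ w * (g * d) * (s * q * k * y)
  hankel-ratio {w} {g} {d} {h} {m} {a} {k} {q} {s} {x} {y} {z} wx wy gdq am za ss = begin
    w * (g * d) * x
      ≈⟨ solve 4 (λ w g d x → w :* (g :* d) :* x := g :* d :* (w :* x)) refl w g d x ⟩
    g * d * (w * x)
      ≈⟨ *-congˡ wx ⟩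
    g * d * (m * h)
      ≈⟨ solve 4 (λ g d m h → g :* d :* (m :* h) := d :* (g :* m :* h)) refl g d m h ⟩
    d * (g * m * h)
      ≈⟨ *-congʳ (trans (sym (-‿involutive d)) (-‿cong (sym za))) ⟩
    - (z * a) * (g * m * h)
      ≈⟨ trans (sym (-‿distribˡ-* _ _)) (-‿cong (solve 5 (λ z a g m h →
           z :* a :* (g :* m :* h) := z :* g :* h :* (a :* m)) refl z a g m h)) ⟩
    - (z * g * h * (a * m))
      ≈⟨ -‿cong (*-congˡ am) ⟩
    - (z * g * h * (w * k))
      ≈⟨ -‿cong (*-identityˡ _) ⟨
    - (1# * (z * g * h * (w * k)))
      ≈⟨ -‿cong (*-congʳ ss) ⟨
    - (s * s * (z * g * h * (w * k)))
      ≈⟨ -1*x≈-x _ ⟨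
    - 1# * (s * s * (z * g * h * (w * k)))
      ≈⟨ solve 7 (λ ν s z g h w k →
           ν :* (s :* s :* (z :* g :* h :* (w :* k))) := z :* (s :* k) :* (ν :* s :* (g :* w) :* h))
           refl (- 1#) s z g h w k ⟩
    z * (s * k) * (- 1# * s * (g * w) * h)
      ≈⟨ *-cong (*-congʳ gdq) wy ⟨
    g * d * q * (s * k) * (w * y)
      ≈⟨ solve 7 (λ w g d q s k y →
           g :* d :* q :* (s :* k) :* (w :* y) := w :* (g :* d) :* (s :* q :* k :* y)) refl w g d q s k y ⟩
    w * (g * d) * (s * q * k * y) ∎

open import Defs

-- Arithmetic of rational numbers given as fractions

/1-+ : ∀ i j → (i ℤ.+ j) ℚ./ 1 ≡ i ℚ./ 1 ℚ.+ j ℚ./ 1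
/1-+ i j = ℚ.toℚᵘ-injective (begin
  ℚ.toℚᵘ ((i ℤ.+ j) ℚ./ 1)                    ≈⟨ ℚ.toℚᵘ-fromℚᵘ (mkℚᵘ (i ℤ.+ j) 0) ⟩
  mkℚᵘ (i ℤ.+ j) 0                            ≡⟨ ≡.cong₂ (λ i j → mkℚᵘ (i ℤ.+ j) 0)
                                                   (ℤ.*-identityʳ i) (ℤ.*-identityʳ j) ⟨
  mkℚᵘ i 0 ℚᵘ.+ mkℚᵘ j 0                      ≈⟨ ℚᵘ.+-cong (ℚ.toℚᵘ-fromℚᵘ (mkℚᵘ i 0))
                                                   (ℚ.toℚᵘ-fromℚᵘ (mkℚᵘ j 0)) ⟨
  ℚ.toℚᵘ (i ℚ./ 1) ℚᵘ.+ ℚ.toℚᵘ (j ℚ./ 1)      ≈⟨ ℚ.toℚᵘ-homo-+ (i ℚ./ 1) (j ℚ./ 1) ⟨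
  ℚ.toℚᵘ (i ℚ./ 1 ℚ.+ j ℚ./ 1)                ∎)
  where open SetoidReasoning ℚᵘ.≃-setoid

/-*-/ : ∀ i j m n → .{{_ : ℕ.NonZero m}} → .{{_ : ℕ.NonZero n}} →
  (i ℚ./ m) ℚ.* (j ℚ./ n) ≡ ((i ℤ.* j) ℚ./ (m ℕ.* n)) {{ℕ.m*n≢0 m n}}
/-*-/ i j (suc m) (suc n) = ℚ.toℚᵘ-injective (begin
  ℚ.toℚᵘ ((i ℚ./ suc m) ℚ.* (j ℚ./ suc n))          ≈⟨ ℚ.toℚᵘ-homo-* (i ℚ./ suc m) (j ℚ./ suc n) ⟩
  ℚ.toℚᵘ (i ℚ./ suc m) ℚᵘ.* ℚ.toℚᵘ (j ℚ./ suc n)    ≈⟨ ℚᵘ.*-cong (ℚ.toℚᵘ-fromℚᵘ (mkℚᵘ i m))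
                                                         (ℚ.toℚᵘ-fromℚᵘ (mkℚᵘ j n)) ⟩
  mkℚᵘ i m ℚᵘ.* mkℚᵘ j n                            ≈⟨ ℚ.toℚᵘ-fromℚᵘ (mkℚᵘ i m ℚᵘ.* mkℚᵘ j n) ⟨
  ℚ.toℚᵘ ((i ℤ.* j) ℚ./ (suc m ℕ.* suc n))          ∎)
  where open SetoidReasoning ℚᵘ.≃-setoid

n/n≡1 : ∀ n → .{{_ : ℕ.NonZero n}} → (+ n) ℚ./ n ≡ 1ℚ
n/n≡1 (suc n) = ℚ.fromℚᵘ-cong {mkℚᵘ (+ suc n) n} {mkℚᵘ (+ 1) 0} (ℚᵘ.*≡* (ℤ.*-comm (+ suc n) (+ 1)))

private
  module ℚ[X] = CommutativeRing ℚ[X]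
  module F = CommutativeRing ℚ⟨X⟩

-- Euler polynomials: functional equation and substitution

module RationalPolynomials where
  open SetoidReasoning ℚ[X].setoid

  const-* : ∀ a b → const (a ℚ.* b) ≈ₚ const a *ₚ const b
  const-* a b = coeffs λ { zero → ≡.sym (ℚ.+-identityʳ (a ℚ.* b)) ; (suc n) → ≡.refl }

  const-cong : ∀ {a b} → a ≡ b → const a ≈ₚ const b
  const-cong ≡.refl = ℚ[X].refl

  -- This supplies integer constants to the ring solver; `⟦ + n ⟧` unfolds to `fromℕ n`, so solved
  -- identities apply to the definitions directly.
  integerPolynomials : ℤ.+-*-rawRing -Raw-AlmostCommutative⟶ fromCommutativeRing ℚ[X]
  integerPolynomials = record
    { ⟦_⟧    = λ i → const (i ℚ./ 1)
    ; +-homo = λ i j → const-cong (/1-+ i j)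
    ; *-homo = λ i j → ℚ[X].trans (const-cong (≡.sym (/-*-/ i j 1 1))) (const-* (i ℚ./ 1) (j ℚ./ 1))
    ; -‿homo = λ i → const-cong (neg i)
    ; 0-homo = coeffs λ { zero → ≡.refl ; (suc n) → ≡.refl }
    ; 1-homo = ℚ[X].refl
    }
    where
    neg : ∀ i → (ℤ.- i) ℚ./ 1 ≡ ℚ.- (i ℚ./ 1)
    neg (+ zero)    = ≡.refl
    neg (+ suc n)   = ≡.refl
    neg ℤ.-[1+ n ]  = ≡.sym
      (RingProperties.-‿involutive (CommutativeRing.ring ℚ.+-*-commutativeRing) (+ suc n ℚ./ 1))

  open Sequences ℚ[X] integerPolynomials public

  fromℕ≈ν : ∀ n → fromℕ n ≈ₚ ν n
  fromℕ≈ν n = ℚ[X].sym (ν≈⟦⟧ n)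

  ν≉0 : ∀ n → .{{ℕ.NonZero n}} → ¬ ν n ≈ₚ []
  ν≉0 n e = fromℕ≉0 n (ℚ[X].trans (fromℕ≈ν n) e)

  1/!-inverse : ∀ n → const (1/ n !) *ₚ fromℕ (n !) ≈ₚ const 1ℚ
  1/!-inverse n = begin
    const (1/ n !) *ₚ fromℕ (n !)        ≈⟨ const-* (1/ n !) (+ (n !) ℚ./ 1) ⟨
    const (1/ n ! ℚ.* (+ (n !) ℚ./ 1))   ≡⟨ ≡.cong const (/-*-/ (+ 1) (+ (n !)) (n !) 1) ⟩
    const ((+ 1 ℤ.* + (n !)) ℚ./ (n ! ℕ.* 1))
      ≡⟨ ≡.cong const (ℚ./-cong {+ 1 ℤ.* + (n !)} (ℤ.*-identityˡ (+ (n !))) (ℕ.*-identityʳ (n !))) ⟩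
    const (+ (n !) ℚ./ (n !))            ≡⟨ ≡.cong const (n/n≡1 (n !)) ⟩
    const 1ℚ                             ∎
    where
    instance
      _ = n ℕ.!≢0
      _ = ℕ.m*n≢0 (n !) 1

  1/!-suc : ∀ n → ν (suc n) *ₚ const (1/ suc n !) ≈ₚ const (1/ n !)
  1/!-suc n = *ₚ-cancelˡ (fromℕ (n !)) _ _ (fromℕ≉0 (n !) {{n ℕ.!≢0}}) (begin
    fromℕ (n !) *ₚ (ν (suc n) *ₚ const (1/ suc n !))
      ≈⟨ solve 3 (λ f n u → f :* (n :* u) := u :* (n :* f)) ℚ[X].refl
           (fromℕ (n !)) (ν (suc n)) (const (1/ suc n !)) ⟩
    const (1/ suc n !) *ₚ (ν (suc n) *ₚ fromℕ (n !))
      ≈⟨ ℚ[X].*-congˡ {const (1/ suc n !)} (ℚ[X].*-congˡ {ν (suc n)} (fromℕ≈ν (n !))) ⟩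
    const (1/ suc n !) *ₚ (ν (suc n) *ₚ ν (n !))
      ≈⟨ ℚ[X].*-congˡ {const (1/ suc n !)} (ν-* (suc n) (n !)) ⟨
    const (1/ suc n !) *ₚ ν (suc n !)
      ≈⟨ ℚ[X].*-congˡ {const (1/ suc n !)} (fromℕ≈ν (suc n !)) ⟨
    const (1/ suc n !) *ₚ fromℕ (suc n !)
      ≈⟨ 1/!-inverse (suc n) ⟩
    const 1ℚ
      ≈⟨ 1/!-inverse n ⟨
    const (1/ n !) *ₚ fromℕ (n !)
      ≈⟨ ℚ[X].*-comm (const (1/ n !)) (fromℕ (n !)) ⟩
    fromℕ (n !) *ₚ const (1/ n !) ∎)

  1^n≈1 : ∀ n → fromℕ 1 ^ₚ n ≈ₚ const 1ℚ
  1^n≈1 zero    = ℚ[X].refl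
  1^n≈1 (suc n) = ℚ[X].trans (ℚ[X].*-congˡ {fromℕ 1} (1^n≈1 n)) (ℚ[X].*-identityˡ _)

  -- Compare coefficients of t^n in the generating function multiplied by e^t + 1: the factor e^t
  -- yields the binomial transform, the summand 1 yields `E n`, and 1/n! is common to all terms.
  E-functional : ∀ n → E n +ₚ binomial E n ≈ₚ fromℕ 2 *ₚ X ^ₚ n
  E-functional n = *ₚ-cancelˡ (const (1/ n !)) _ _ 1/n!≉0 (begin
    u n *ₚ (E n +ₚ binomial E n)
      ≈⟨ ℚ[X].trans (ℚ[X].distribˡ (u n) (E n) (binomial E n)) (ℚ[X].+-comm (u n *ₚ E n) _) ⟩
    u n *ₚ binomial E n +ₚ u n *ₚ E n
      ≈⟨ ℚ[X].+-cong (⊗-binomial u ℚ[X].refl 1/!-suc (λ n → *ₚ-cancelˡ (ν (suc n)) _ _ (ν≉0 (suc n))) E n)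
           (ℚ[X].*-identityʳ (u n *ₚ E n)) ⟨
    (f ⊗ u) n +ₚ u n *ₚ E n *ₚ fromℕ 1
      ≈⟨ ℚ[X].+-cong (⊗-congʳ f (λ m →
             ℚ[X].trans (ℚ[X].*-congˡ {u m} (1^n≈1 m)) (ℚ[X].*-identityʳ (u m))) n)
           (⊗-constant f (fromℕ 1) n) ⟨
    (f ⊗ exp (fromℕ 1)) n +ₚ (f ⊗ constant (fromℕ 1)) n
      ≈⟨ ⊗-distribˡ-⊕ f (exp (fromℕ 1)) (constant (fromℕ 1)) n ⟨
    (f ⊗ e^t+1) n
      ≈⟨ E-generating-function n ⟩
    (constant (fromℕ 2) ⊗ exp X) n
      ≈⟨ constant-⊗ (fromℕ 2) (exp X) n ⟩
    fromℕ 2 *ₚ (u n *ₚ X ^ₚ n)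
      ≈⟨ solve 3 (λ a u x → a :* (u :* x) := u :* (a :* x)) ℚ[X].refl (fromℕ 2) (u n) (X ^ₚ n) ⟩
    u n *ₚ (fromℕ 2 *ₚ X ^ₚ n) ∎)
    where
    open ExponentialSeries
    u : Series
    u m = const (1/ m !)

    f : Series
    f m = u m *ₚ E m

    1/n!≉0 : ¬ u n ≈ₚ []
    1/n!≉0 e = 1≉0ₚ (ℚ[X].trans (ℚ[X].sym (1/!-inverse n))
      (ℚ[X].trans (ℚ[X].*-congʳ {fromℕ (n !)} e) (ℚ[X].zeroˡ (fromℕ (n !)))))

  const0≈0 : const 0ℚ ≈ₚ []
  const0≈0 = _-Raw-AlmostCommutative⟶_.0-homo integerPolynomials

  module _ (r : Poly) where

    -- Equality ignores trailing zeros, so a polynomial equal to zero may be a nonempty list;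
    -- `∘-cong` needs this when the two lists differ in length.
    ∘-zero : ∀ p → p ≈ₚ [] → p ∘ₚ r ≈ₚ []
    ∘-zero []      e = ℚ[X].refl
    ∘-zero (a ∷ p) e = begin
      const a +ₚ r *ₚ (p ∘ₚ r)
        ≈⟨ ℚ[X].+-cong (ℚ[X].trans (const-cong (at e 0)) const0≈0)
             (ℚ[X].*-congˡ {r} (∘-zero p (coeffs λ n → at e (suc n)))) ⟩
      r *ₚ []  ≈⟨ ℚ[X].zeroʳ r ⟩
      []       ∎

    ∘-cong : ∀ p q → p ≈ₚ q → p ∘ₚ r ≈ₚ q ∘ₚ r
    ∘-cong []      q       e = ℚ[X].sym (∘-zero q (ℚ[X].sym e))
    ∘-cong (a ∷ p) []      e = ∘-zero (a ∷ p) e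
    ∘-cong (a ∷ p) (b ∷ q) e = ℚ[X].+-cong (const-cong (at e 0))
      (ℚ[X].*-congˡ {r} (∘-cong p q (coeffs λ n → at e (suc n))))

    ∘-+ : ∀ p q → (p +ₚ q) ∘ₚ r ≈ₚ p ∘ₚ r +ₚ q ∘ₚ r
    ∘-+ []      q       = ℚ[X].refl
    ∘-+ (a ∷ p) []      = ℚ[X].sym (ℚ[X].+-identityʳ _)
    ∘-+ (a ∷ p) (b ∷ q) = ℚ[X].trans (ℚ[X].+-congˡ {const a +ₚ const b} (ℚ[X].*-congˡ {r} (∘-+ p q)))
      (solve 5 (λ a b r p q → a :+ b :+ r :* (p :+ q) := a :+ r :* p :+ (b :+ r :* q)) ℚ[X].refl
        (const a) (const b) r (p ∘ₚ r) (q ∘ₚ r))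

    ∘-· : ∀ a p → (a · p) ∘ₚ r ≈ₚ const a *ₚ (p ∘ₚ r)
    ∘-· a []      = ℚ[X].sym (ℚ[X].zeroʳ (const a))
    ∘-· a (b ∷ p) = ℚ[X].trans (ℚ[X].+-cong (const-* a b) (ℚ[X].*-congˡ {r} (∘-· a p)))
      (solve 4 (λ a b r p → a :* b :+ r :* (a :* p) := a :* (b :+ r :* p)) ℚ[X].refl
        (const a) (const b) r (p ∘ₚ r))

    ∘-* : ∀ p q → (p *ₚ q) ∘ₚ r ≈ₚ (p ∘ₚ r) *ₚ (q ∘ₚ r)
    ∘-* []      q = ℚ[X].refl
    ∘-* (a ∷ p) q = begin
      (a · q +ₚ (0ℚ ∷ p *ₚ q)) ∘ₚ r
        ≈⟨ ∘-+ (a · q) (0ℚ ∷ p *ₚ q) ⟩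
      (a · q) ∘ₚ r +ₚ (const 0ℚ +ₚ r *ₚ ((p *ₚ q) ∘ₚ r))
        ≈⟨ ℚ[X].+-cong (∘-· a q) (ℚ[X].+-cong const0≈0 (ℚ[X].*-congˡ {r} (∘-* p q))) ⟩
      const a *ₚ (q ∘ₚ r) +ₚ r *ₚ ((p ∘ₚ r) *ₚ (q ∘ₚ r))
        ≈⟨ solve 4 (λ a r p q → a :* q :+ r :* (p :* q) := (a :+ r :* p) :* q) ℚ[X].refl
             (const a) r (p ∘ₚ r) (q ∘ₚ r) ⟩
      (const a +ₚ r *ₚ (p ∘ₚ r)) *ₚ (q ∘ₚ r) ∎

    ∘-const : ∀ a → const a ∘ₚ r ≈ₚ const a
    ∘-const a = ℚ[X].trans (ℚ[X].+-congˡ {const a} (ℚ[X].zeroʳ r)) (ℚ[X].+-identityʳ (const a))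

    X∘ : X ∘ₚ r ≈ₚ r
    X∘ = begin
      const 0ℚ +ₚ r *ₚ (const 1ℚ ∘ₚ r)  ≈⟨ ℚ[X].+-cong const0≈0 (ℚ[X].*-congˡ {r} (∘-const 1ℚ)) ⟩
      r *ₚ const 1ℚ                     ≈⟨ ℚ[X].*-identityʳ r ⟩
      r                                 ∎

    X^∘ : ∀ n → (X ^ₚ n) ∘ₚ r ≈ₚ r ^ₚ n
    X^∘ zero    = ∘-const 1ℚ
    X^∘ (suc n) = ℚ[X].trans (∘-* X (X ^ₚ n)) (ℚ[X].*-cong X∘ (X^∘ n))

    binomial-∘ : ∀ a n → binomial a n ∘ₚ r ≈ₚ binomial (λ m → a m ∘ₚ r) n
    binomial-∘ a zero    = ℚ[X].refl
    binomial-∘ a (suc n) = ℚ[X].trans (∘-+ (binomial a n) (binomial (λ m → a (suc m)) n))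
      (ℚ[X].+-cong (binomial-∘ a n) (binomial-∘ (λ m → a (suc m)) n))

    E∘-functional : ∀ n → E n ∘ₚ r +ₚ binomial (λ m → E m ∘ₚ r) n ≈ₚ fromℕ 2 *ₚ r ^ₚ n
    E∘-functional n = begin
      E n ∘ₚ r +ₚ binomial (λ m → E m ∘ₚ r) n   ≈⟨ ℚ[X].+-congˡ {E n ∘ₚ r} (binomial-∘ E n) ⟨
      E n ∘ₚ r +ₚ binomial E n ∘ₚ r             ≈⟨ ∘-+ (E n) (binomial E n) ⟨
      (E n +ₚ binomial E n) ∘ₚ r                ≈⟨ ∘-cong _ _ (E-functional n) ⟩
      (fromℕ 2 *ₚ X ^ₚ n) ∘ₚ r                  ≈⟨ ∘-* (fromℕ 2) (X ^ₚ n) ⟩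
      (fromℕ 2 ∘ₚ r) *ₚ ((X ^ₚ n) ∘ₚ r)         ≈⟨ ℚ[X].*-cong (∘-const (+ 2 ℚ./ 1)) (X^∘ n) ⟩
      fromℕ 2 *ₚ r ^ₚ n                         ∎

-- Specialisation to y = (x + 1)/2

open RationalPolynomials
open WithParameter ½[X+1]
open EvenPart (λ n → E n ∘ₚ ½[X+1]) (E∘-functional ½[X+1])
  (λ _ _ → *ₚ-cancelˡ (fromℕ 2) _ _ (fromℕ≉0 2))

b-suc : ∀ k → b (suc k) ≈ₚ even k
b-suc k = ℚ[X].reflexive (≡.cong (λ m → E (m ∸ 2) ∘ₚ ½[X+1]) (ℕ.*-suc 2 k))

open Shifted even b ℚ[X].refl b-suc central-even≈moment

open Convergents ℚ⟨X⟩
open Combination ℚ⟨X⟩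

-- With 2y = x + 1 the doubled factors of `A n` are 2n + 1 - x and x + 1 + 2n, whose product is a
-- difference of squares.
4A : ∀ n → fromℕ 4 *ₚ A n ≈ₚ fromℕ ((2 ℕ.* n ℕ.+ 1) ℕ.^ 2) -ₚ X ^ₚ 2
4A n = begin
  fromℕ 4 *ₚ A n
    ≈⟨ solve 2 (λ n y → con (+ 4) :* ((con (+ 1) :+ n :- y) :* (y :+ n)) :=
         let 2y = con (+ 2) :* y ; 2n = con (+ 2) :* n in
         (2n :+ con (+ 2) :- 2y) :* (2y :+ 2n)) ℚ[X].refl (ν n) ½[X+1] ⟩
  (fromℕ 2 *ₚ ν n +ₚ fromℕ 2 -ₚ fromℕ 2 *ₚ ½[X+1]) *ₚ (fromℕ 2 *ₚ ½[X+1] +ₚ fromℕ 2 *ₚ ν n)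
    ≈⟨ ℚ[X].*-cong (ℚ[X].+-congˡ {fromℕ 2 *ₚ ν n +ₚ fromℕ 2} (ℚ[X].-‿cong 2y))
         (ℚ[X].+-congʳ {fromℕ 2 *ₚ ν n} 2y) ⟩
  (fromℕ 2 *ₚ ν n +ₚ fromℕ 2 -ₚ (X +ₚ fromℕ 1)) *ₚ (X +ₚ fromℕ 1 +ₚ fromℕ 2 *ₚ ν n)
    -- The trailing factors `one` reproduce the way a second power unfolds.
    ≈⟨ solve 2 (λ n x → let 2n = con (+ 2) :* n ; one = con (+ 1) in
         (2n :+ con (+ 2) :- (x :+ one)) :* (x :+ one :+ 2n)
         := (2n :+ one) :* ((2n :+ one) :* one) :- x :* (x :* one))
         ℚ[X].refl (ν n) X ⟩
  (fromℕ 2 *ₚ ν n +ₚ fromℕ 1) *ₚ ((fromℕ 2 *ₚ ν n +ₚ fromℕ 1) *ₚ fromℕ 1) -ₚ X ^ₚ 2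
    ≈⟨ ℚ[X].+-congʳ { -ₚ X ^ₚ 2} square ⟨
  fromℕ ((2 ℕ.* n ℕ.+ 1) ℕ.^ 2) -ₚ X ^ₚ 2 ∎
  where
  open SetoidReasoning ℚ[X].setoid
  open _-Raw-AlmostCommutative⟶_ integerPolynomials using (+-homo; *-homo)
  2y : fromℕ 2 *ₚ ½[X+1] ≈ₚ X +ₚ fromℕ 1
  2y = coeffs λ { 0 → ≡.refl ; 1 → ≡.refl ; (suc (suc n)) → ≡.refl }

  odd : fromℕ (2 ℕ.* n ℕ.+ 1) ≈ₚ fromℕ 2 *ₚ ν n +ₚ fromℕ 1
  odd = begin
    fromℕ (2 ℕ.* n ℕ.+ 1)              ≈⟨ +-homo (+ (2 ℕ.* n)) (+ 1) ⟩
    fromℕ (2 ℕ.* n) +ₚ fromℕ 1         ≡⟨ ≡.cong (λ i → const (i ℚ./ 1) +ₚ fromℕ 1) (ℤ.pos-* 2 n) ⟩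
    const ((+ 2 ℤ.* + n) ℚ./ 1) +ₚ fromℕ 1  ≈⟨ ℚ[X].+-congʳ {fromℕ 1} (*-homo (+ 2) (+ n)) ⟩
    fromℕ 2 *ₚ fromℕ n +ₚ fromℕ 1      ≈⟨ ℚ[X].+-congʳ {fromℕ 1} (ℚ[X].*-congˡ {fromℕ 2} (fromℕ≈ν n)) ⟩
    fromℕ 2 *ₚ ν n +ₚ fromℕ 1          ∎

  square : fromℕ ((2 ℕ.* n ℕ.+ 1) ℕ.^ 2)
    ≈ₚ (fromℕ 2 *ₚ ν n +ₚ fromℕ 1) *ₚ ((fromℕ 2 *ₚ ν n +ₚ fromℕ 1) *ₚ fromℕ 1)
  square = ℚ[X].trans (fromℕ-* (2 ℕ.* n ℕ.+ 1) _) (ℚ[X].*-cong odd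
    (ℚ[X].trans (fromℕ-* (2 ℕ.* n ℕ.+ 1) 1) (ℚ[X].*-congʳ {fromℕ 1} odd)))
    where
    fromℕ-* : ∀ m n → fromℕ (m ℕ.* n) ≈ₚ fromℕ m *ₚ fromℕ n
    fromℕ-* m n = ℚ[X].trans
      (ℚ[X].reflexive (≡.cong (λ i → const (i ℚ./ 1)) (ℤ.pos-* m n))) (*-homo (+ m) (+ n))

A≉0 : ∀ n → ¬ A n ≈ₚ []
A≉0 n e = m-X²≉0 ((2 ℕ.* n ℕ.+ 1) ℕ.^ 2)
  (ℚ[X].trans (ℚ[X].sym (4A n)) (ℚ[X].trans (ℚ[X].*-congˡ {fromℕ 4} e) (ℚ[X].zeroʳ (fromℕ 4))))

W≉0 : ∀ n → ¬ W n ≈ₚ []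
W≉0 zero    = 1≉0ₚ
W≉0 (suc n) = *-≉0 (A≉0 n) (W≉0 n)

-- Passage to the field of fractions

ι-cong : ∀ {p q} → p ≈ₚ q → ι p ≈ ι q
ι-cong {p} {q} e = *≈* (ℚ[X].*-congʳ {const 1ℚ} e)

ι-+ : ∀ p q → ι (p +ₚ q) ≈ ι p + ι q
ι-+ p q = *≈* (solve 2 (λ p q → (p :+ q) :* (con (+ 1) :* con (+ 1)) :=
  (p :* con (+ 1) :+ q :* con (+ 1)) :* con (+ 1)) ℚ[X].refl p q)

ι-* : ∀ p q → ι (p *ₚ q) ≈ ι p * ι q
ι-* p q = *≈* (solve 2 (λ p q → (p :* q) :* (con (+ 1) :* con (+ 1)) :=
  (p :* q) :* con (+ 1)) ℚ[X].refl p q)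

ι-cancelˡ : ∀ {w x z} → ¬ w ≈ₚ [] → ι w * x ≈ ι w * z → x ≈ z
ι-cancelˡ {w} {x / x′ [ _ ]} {z / z′ [ _ ]} w≉0 (*≈* e) = *≈* (*ₚ-cancelˡ w _ _ w≉0 (begin
  w *ₚ (x *ₚ z′)                  ≈⟨ lemma x z′ ⟩
  (w *ₚ x) *ₚ (const 1ℚ *ₚ z′)    ≈⟨ e ⟩
  (w *ₚ z) *ₚ (const 1ℚ *ₚ x′)    ≈⟨ lemma z x′ ⟨
  w *ₚ (z *ₚ x′)                  ∎))
  where
  open SetoidReasoning ℚ[X].setoid
  lemma : ∀ x z → w *ₚ (x *ₚ z) ≈ₚ (w *ₚ x) *ₚ (const 1ℚ *ₚ z)
  lemma = solve 3 (λ w x z → w :* (x :* z) := (w :* x) :* (con (+ 1) :* z)) ℚ[X].refl w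

ι-/ : ∀ p {q} q≉0 → ι q * (p / q [ q≉0 ]) ≈ ι p
ι-/ p {q} q≉0 = *≈* (solve 2 (λ p q → (q :* p) :* con (+ 1) := p :* (con (+ 1) :* q))
  ℚ[X].refl p q)

[2n]²≈4n² : ∀ n → fromℕ ((2 ℕ.* n) ℕ.^ 2) ≈ₚ fromℕ 4 *ₚ (ν n *ₚ ν n)
[2n]²≈4n² n = let open SetoidReasoning ℚ[X].setoid in begin
  fromℕ ((2 ℕ.* n) ℕ.^ 2)          ≡⟨ ≡.cong (λ m → fromℕ (2 ℕ.* n ℕ.* m)) (ℕ.*-identityʳ (2 ℕ.* n)) ⟩
  fromℕ (2 ℕ.* n ℕ.* (2 ℕ.* n))    ≡⟨ ≡.cong fromℕ (ℕ.[m*n]*[o*p]≡[m*o]*[n*p] 2 n 2 n) ⟩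
  fromℕ (4 ℕ.* (n ℕ.* n))          ≈⟨ fromℕ≈ν (4 ℕ.* (n ℕ.* n)) ⟩
  ν (4 ℕ.* (n ℕ.* n))              ≈⟨ ν-* 4 (n ℕ.* n) ⟩
  ν 4 *ₚ ν (n ℕ.* n)               ≈⟨ ℚ[X].*-cong (ℚ[X].sym (fromℕ≈ν 4)) (ν-* n n) ⟩
  fromℕ 4 *ₚ (ν n *ₚ ν n)          ∎

-- After multiplication by 4, `A n` becomes the denominator of `factor n`, whose numerator is 4n².
-- This is the relation between a, φ and g that `a₀*m` requires.
A*factor : ∀ n → ι (A n) * factor n ≈ ι (ν n *ₚ ν n)
A*factor n = let open SetoidReasoning F.setoid in ι-cancelˡ {fromℕ 4} (fromℕ≉0 4) (begin
  ι (fromℕ 4) * (ι (A n) * factor n)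
    ≈⟨ F.*-assoc (ι (fromℕ 4)) (ι (A n)) (factor n) ⟨
  ι (fromℕ 4) * ι (A n) * factor n
    ≈⟨ F.*-congʳ {factor n} (F.trans (F.sym (ι-* (fromℕ 4) (A n))) (ι-cong (4A n))) ⟩
  ι (fromℕ ((2 ℕ.* n ℕ.+ 1) ℕ.^ 2) -ₚ X ^ₚ 2) * factor n
    ≈⟨ ι-/ (fromℕ ((2 ℕ.* n) ℕ.^ 2)) (m-X²≉0 ((2 ℕ.* n ℕ.+ 1) ℕ.^ 2)) ⟩
  ι (fromℕ ((2 ℕ.* n) ℕ.^ 2))
    ≈⟨ F.trans (ι-cong ([2n]²≈4n² n)) (ι-* (fromℕ 4) (ν n *ₚ ν n)) ⟩
  ι (fromℕ 4) * ι (ν n *ₚ ν n) ∎)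

ι-[-1]^ : ∀ n → ι ((-ₚ const 1ℚ) ^ₚ n) ≈ (- 1#) ^ n
ι-[-1]^ zero    = F.refl
ι-[-1]^ (suc n) = F.trans (ι-* (-ₚ const 1ℚ) ((-ₚ const 1ℚ) ^ₚ n)) (F.*-congˡ {ι (-ₚ const 1ℚ)} (ι-[-1]^ n))

[-1]^-square : ∀ n → (- 1#) ^ n * (- 1#) ^ n ≈ 1#
[-1]^-square zero    = F.*-identityˡ 1#
[-1]^-square (suc n) = F.trans (*.interchange (- 1#) ((- 1#) ^ n) (- 1#) ((- 1#) ^ n))
  (F.trans (F.*-cong -1*-1 ([-1]^-square n)) (F.*-identityˡ 1#))
  where
  module * = CommutativeSemigroupProperties F.*-commutativeSemigroup
  -1*-1 : - 1# * - 1# ≈ 1#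
  -1*-1 = F.trans (-1*x≈-x (- 1#)) (-‿involutive 1#)
    where open RingProperties F.ring using (-1*x≈-x; -‿involutive)

ν[n!]² : ∀ n → fromℕ ((n !) ℕ.^ 2) ≈ₚ ν (n !) *ₚ ν (n !)
ν[n!]² n = ℚ[X].trans (ℚ[X].reflexive (≡.cong (λ m → fromℕ (n ! ℕ.* m)) (ℕ.*-identityʳ (n !))))
  (ℚ[X].trans (fromℕ≈ν (n ! ℕ.* n !)) (ν-* (n !) (n !)))

A₀*M : ∀ k → ι (A 0) * ι (M (suc k)) ≈ ι (W (suc k)) * 𝒦 (suc k)
A₀*M = a₀*m (λ n → ι (A n)) factor (λ n → ι (ν (n !) *ₚ ν (n !))) (λ n → ι (W n)) (λ n → ι (M n))
  (ι-cong (ℚ[X].*-identityʳ (A 0)))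
  (λ k → ι-* (A (suc k)) (W (suc k)))
  (ι-cong M₁)
  (λ k → F.trans (ι-cong (M-suc (suc k))) (F.trans (ι-+ (g (suc k)) (A (suc k) *ₚ M (suc k)))
    (F.+-congˡ {ι (g (suc k))} (ι-* (A (suc k)) (M (suc k))))))
  (ι-cong g₀)
  (λ k → F.trans (ι-cong (ν-suc-! k)) (F.trans (ι-* (ν (suc k) *ₚ ν (suc k)) (g k))
    (F.*-congʳ {ι (g k)} (F.sym (A*factor (suc k))))))
  where
  g : ℕ → Poly
  g n = ν (n !) *ₚ ν (n !)

  g₀ : g 0 ≈ₚ const 1ℚ
  g₀ = ℚ[X].sym (ν[n!]² 0)

  M₁ : M 1 ≈ₚ const 1ℚ
  -- `M 0` unfolds to `b 0`, which is zero, so only 0!² = 1 remains.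
  M₁ = ℚ[X].trans (M-suc 0) (ℚ[X].trans (ℚ[X].+-cong g₀ (ℚ[X].zeroʳ (A 0))) (ℚ[X].+-identityʳ (const 1ℚ)))

4A₀ : fromℕ 4 *ₚ A 0 ≈ₚ -ₚ (X ^ₚ 2 -ₚ fromℕ 1)
4A₀ = ℚ[X].trans (4A 0) (solve 1 (λ x → con (+ 1) :- x := :- (x :- con (+ 1))) ℚ[X].refl (X ^ₚ 2))

proposition7p2 : ∀ (n : ℕ) → 1 ≤ n →
    ι (H n b)
    ≈ (- 1#) ^ (n ∸ 1)
    * (fromℕ 4 / (fromℕ ((n !) ℕ.^ 2) *ₚ (X ^ₚ 2 -ₚ fromℕ 1)) [ n!²[X²-1]≉0 n ])
    * 𝒦 n
    * ι (H n (λ k → E (2 ℕ.* k) ∘ₚ ½[X+1]))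
-- The multiplier consists of P_n(0) and the denominator n!²(x² - 1); neither part is zero, so it
-- can be cancelled in ℚ(X).
proposition7p2 n@(suc k) _ = ι-cancelˡ {W n *ₚ (g *ₚ d)} (*-≉0 (W≉0 n) (n!²[X²-1]≉0 n)) (begin
  ι (W n *ₚ (g *ₚ d)) * ι (H n b)
    ≈⟨ F.*-congʳ {ι (H n b)} split ⟩
  ι (W n) * (ι g * ι d) * ι (H n b)
    ≈⟨ hankel-ratio {ι (W n)} {ι g} {ι d} {ι (shiftedHankel n)} {ι (M n)} {ι (A 0)} {𝒦 n} {q} {(- 1#) ^ k}
         {ι (H n b)} {ι (H n even)} {ι (fromℕ 4)} wx wy gdq (A₀*M k) za ([-1]^-square k) ⟩
  ι (W n) * (ι g * ι d) * rhs
    ≈⟨ F.*-congʳ {rhs} split ⟨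
  ι (W n *ₚ (g *ₚ d)) * rhs ∎)
  where
  open SetoidReasoning F.setoid
  g d : Poly
  g = fromℕ ((n !) ℕ.^ 2)
  d = X ^ₚ 2 -ₚ fromℕ 1

  q rhs : Fraction
  q = fromℕ 4 / (g *ₚ d) [ n!²[X²-1]≉0 n ]
  rhs = (- 1#) ^ k * q * 𝒦 n * ι (H n even)

  split : ι (W n *ₚ (g *ₚ d)) ≈ ι (W n) * (ι g * ι d)
  split = F.trans (ι-* (W n) (g *ₚ d)) (F.*-congˡ {ι (W n)} (ι-* g d))

  wx : ι (W n) * ι (H n b) ≈ ι (M n) * ι (shiftedHankel n)
  wx = F.trans (F.sym (ι-* (W n) (H n b))) (F.trans (ι-cong (W*hankel-b n)) (ι-* (M n) (shiftedHankel n)))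

  -- As `n` is `suc k`, the power (-1)^n unfolds to -1 times (-1)^k. The extra -1 meets the sign in
  -- 4A_0 = -(x² - 1), which leaves (-1)^(n-1).
  wy : ι (W n) * ι (H n even) ≈ - 1# * (- 1#) ^ k * (ι g * ι (W n)) * ι (shiftedHankel n)
  wy = begin
    ι (W n) * ι (H n even)
      ≈⟨ ι-* (W n) (H n even) ⟨
    ι (W n *ₚ H n even)
      ≈⟨ ι-cong (W*hankel-a n) ⟩
    ι ((-ₚ const 1ℚ) ^ₚ n *ₚ (g′ *ₚ W n) *ₚ shiftedHankel n)
      ≈⟨ F.trans (ι-* ((-ₚ const 1ℚ) ^ₚ n *ₚ (g′ *ₚ W n)) (shiftedHankel n))
           (F.*-congʳ {ι (shiftedHankel n)} (ι-* ((-ₚ const 1ℚ) ^ₚ n) (g′ *ₚ W n))) ⟩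
    ι ((-ₚ const 1ℚ) ^ₚ n) * ι (g′ *ₚ W n) * ι (shiftedHankel n)
      ≈⟨ F.*-congʳ {ι (shiftedHankel n)} (F.*-cong (ι-[-1]^ n)
           (F.trans (ι-cong (ℚ[X].*-congʳ {W n} (ℚ[X].sym (ν[n!]² n)))) (ι-* g (W n)))) ⟩
    - 1# * (- 1#) ^ k * (ι g * ι (W n)) * ι (shiftedHankel n) ∎
    where g′ = ν (n !) *ₚ ν (n !)

  gdq : ι g * ι d * q ≈ ι (fromℕ 4)
  gdq = F.trans (F.*-congʳ {q} (F.sym (ι-* g d))) (ι-/ (fromℕ 4) (n!²[X²-1]≉0 n))

  za : ι (fromℕ 4) * ι (A 0) ≈ - ι d
  za = F.trans (F.sym (ι-* (fromℕ 4) (A 0))) (ι-cong 4A₀)
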